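{- For every real $\epsilon > 0$, $T_{k} = O(k^{5/2+\epsilon})$ as $k \to \infty$; that is, for every $\epsilon > 0$ there is a constant $C = C(\epsilon) > 0$ such that $T_k \leq C\, k^{5/2+\epsilon}$ for all integers $k \geq 3$.
   Context: Here $\mathbb{N}$ is the set of positive integers and $[m] = \{1, 2, \dots, m\}$. A $t$-coloring of $[tn]$ assigns to each element of $[tn]$ one of $t$ colors; it is called equinumerous if each color is used an equal number of times (i.e. each of the $t$ colors is used exactly $n$ times). An $AP(k)$ is an arithmetic progression of length $k$, i.e. a set $\{a, a+d, \dots, a+(k-1)d\}$ with common difference $d \geq 1$; it lies in $[tn]$ if all of its terms do. An arithmetic progression is called rainbow (with respect to a coloring) if no two of its terms have the same color. For an integer $k \geq 3$, $T_k$ denotes the minimal number $t \in \mathbb{N}$ such that for every $n \in \mathbb{N}$, every equinumerous $t$-coloring of $[tn]$ contains a rainbow $AP(k)$. (It is known that such a $t$ exists for every $k \geq 3$, so $T_k$ is well defined.) -}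

module Defs where

open import Data.Nat.Base as ℕ using (ℕ; zero; suc)
import Data.Nat.Properties as ℕ
open import Data.Integer.Base as ℤ using (ℤ; +_; -[1+_])
import Data.Integer.Properties as ℤ
open import Data.Rational.Base as ℚ
  using (ℚ; 0ℚ; 1ℚ; _/_; _<_; _≤_; _+_; _*_; _-_; Positive; ↥_; ↧ₙ_)
import Data.Rational.Properties as ℚ
import Data.Rational.Unnormalised.Base as ℚᵘ
import Data.Rational.Unnormalised.Properties as ℚᵘ
open import Data.Rational.Solver using (module +-*-Solver)
open import Data.Fin.Base using (Fin; toℕ)
import Data.Fin.Properties as Fin
open import Data.List.Base using (length; filter; allFin)
open import Data.Product using (∃; ∃-syntax; _×_; _,_; proj₁; proj₂)
open import Data.Sum using (_⊎_; inj₁; inj₂; [_,_])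
open import Function.Base using (_∘_)
open import Function.Definitions using (Injective)
open import Level using (0ℓ)
open import Relation.Binary.PropositionalEquality hiding ([_])
open import Relation.Binary.Definitions using (tri<; tri≈; tri>)
open import Relation.Nullary using (¬_; yes; no; contradiction)
open import Relation.Unary using (Pred)
open import Algebra.Bundles using (CommutativeRing)
open import Algebra.Definitions.RawSemiring ℚ.+-*-rawSemiring using (_^_)
import Algebra.Properties.CommutativeSemiring.Exp
  (CommutativeRing.commutativeSemiring ℚ.+-*-commutativeRing) as Exp

-- The index i : Fin m stands for the element suc (toℕ i) of {1, …, m}.
record AP (k m : ℕ) : Set where
  field
    start difference : ℕ
    difference>0     : 0 ℕ.< difference
    term             : Fin k → Fin m
    term-eq          : ∀ i → suc (toℕ (term i)) ≡ start ℕ.+ toℕ i ℕ.* difference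

Coloring : ℕ → ℕ → Set
Coloring t m = Fin m → Fin t

colorCount : ∀ {t m} → Coloring t m → Fin t → ℕ
colorCount {m = m} c j = length (filter (λ i → c i Fin.≟ j) (allFin m))

Equinumerous : ∀ {t} n → Coloring t (t ℕ.* n) → Set
Equinumerous n c = ∀ j → colorCount c j ≡ n

Rainbow : ∀ {t m k} → Coloring t m → AP k m → Set
Rainbow c A = Injective _≡_ _≡_ (c ∘ AP.term A)

ForcesRainbow : ℕ → ℕ → Set
ForcesRainbow k t =
  ∀ n → 0 ℕ.< n → (c : Coloring t (t ℕ.* n)) → Equinumerous n c →
  ∃[ A ] Rainbow {k = k} c A

-- T_k is given by its graph, since a least element of an undecidable set of
-- naturals cannot be computed.
IsT : ℕ → ℕ → Set
IsT k t =
  0 ℕ.< t × ForcesRainbow k t × (∀ s → 0 ℕ.< s → ForcesRainbow k s → t ℕ.≤ s)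

-- Two-sided Dedekind cuts; L 0ℚ expresses positivity.
record ℝ⁺ : Set₁ where
  field
    L U        : Pred ℚ 0ℓ
    L-zero     : L 0ℚ
    U-nonempty : ∃ U
    L-down     : ∀ {r s} → r < s → L s → L r
    U-up       : ∀ {r s} → r < s → U r → U s
    L-open     : ∀ {r} → L r → ∃[ s ] r < s × L s
    U-open     : ∀ {s} → U s → ∃[ r ] r < s × U r
    disjoint   : ∀ {r} → L r → ¬ U r
    located    : ∀ {r s} → r < s → L r ⊎ U s

open ℝ⁺

infix 4 _≤ʳ_

_≤ʳ_ : ℝ⁺ → ℝ⁺ → Set
x ≤ʳ y = ∀ r → L x r → L y r

fromℚ : (q : ℚ) → .{{Positive q}} → ℝ⁺
fromℚ q = record
  { L          = _< q
  ; U          = q <_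
  ; L-zero     = ℚ.positive⁻¹ q
  ; U-nonempty = q + 1ℚ , subst (_< q + 1ℚ) (ℚ.+-identityʳ q) (ℚ.+-monoʳ-< q (ℚ.positive⁻¹ 1ℚ))
  ; L-down     = ℚ.<-trans
  ; U-up       = λ r<s q<r → ℚ.<-trans q<r r<s
  ; L-open     = λ r<q → let s , r<s , s<q = ℚ.<-dense r<q in s , r<s , s<q
  ; U-open     = λ q<s → let r , q<r , r<s = ℚ.<-dense q<s in r , r<s , q<r
  ; disjoint   = ℚ.<-asym
  ; located    = loc
  }
  where
  loc : ∀ {r s} → r < s → r < q ⊎ q < s
  loc {r} r<s with r ℚ.<? q
  ... | yes r<q = inj₁ r<q
  ... | no  r≮q = inj₂ (ℚ.≤-<-trans (ℚ.≮⇒≥ r≮q) r<s)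

fromℕ : (n : ℕ) → .{{ℕ.NonZero n}} → ℝ⁺
fromℕ n = fromℚ (+ n / 1) {{ℚ.normalize-pos n 1}}

ι : ℕ → ℚ
ι n = + n / 1

ι-mono-≤ : ∀ {m n} → m ℕ.≤ n → ι m ≤ ι n
ι-mono-≤ {m} {n} m≤n = ℚ.toℚᵘ-cancel-≤
  (ℚᵘ.≤-respˡ-≃ (ℚᵘ.≃-sym (ℚ.toℚᵘ-fromℚᵘ (ℚᵘ.mkℚᵘ (+ m) 0)))
  (ℚᵘ.≤-respʳ-≃ (ℚᵘ.≃-sym (ℚ.toℚᵘ-fromℚᵘ (ℚᵘ.mkℚᵘ (+ n) 0)))
  (ℚᵘ.*≤* (ℤ.*-monoʳ-≤-nonNeg (+ 1) (ℤ.+≤+ m≤n)))))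

ι-suc : ∀ n → ι (suc n) ≡ 1ℚ + ι n
ι-suc n = ℚ.toℚᵘ-injective (ℚᵘ.≃-trans (ℚ.toℚᵘ-fromℚᵘ (ℚᵘ.mkℚᵘ (+ suc n) 0))
  (ℚᵘ.≃-trans (ℚᵘ.*≡* (cong (λ z → (+ 1 ℤ.+ z) ℤ.* + 1) (sym (ℤ.*-identityʳ (+ n)))))
  (ℚᵘ.≃-sym (ℚᵘ.≃-trans (ℚ.toℚᵘ-homo-+ 1ℚ (ι n))
    (ℚᵘ.+-congʳ ℚᵘ.1ℚᵘ (ℚ.toℚᵘ-fromℚᵘ (ℚᵘ.mkℚᵘ (+ n) 0)))))))

archimedean : ∀ q → ∃[ n ] q < ι n
archimedean q@(ℚ.mkℚ i d _) = suc ℤ.∣ i ∣ , ℚ.toℚᵘ-cancel-<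
  (ℚᵘ.<-respʳ-≃ (ℚᵘ.≃-sym (ℚ.toℚᵘ-fromℚᵘ (ℚᵘ.mkℚᵘ (+ suc ℤ.∣ i ∣) 0))) (ℚᵘ.*<* (bound i)))
  where
  bound : ∀ i → i ℤ.* + 1 ℤ.< + suc ℤ.∣ i ∣ ℤ.* + suc d
  bound (+ n)    rewrite ℤ.*-identityʳ (+ n) = ℤ.+<+ (ℕ.m≤m*n (suc n) (suc d))
  bound -[1+ n ] = ℤ.-<+

module S = +-*-Solver

0<1 : 0ℚ < 1ℚ
0<1 = ℚ.positive⁻¹ 1ℚ

0≤1 : 0ℚ ≤ 1ℚ
0≤1 = ℚ.<⇒≤ 0<1

x<x+d : ∀ x {d} → 0ℚ < d → x < x + d
x<x+d x {d} 0<d = subst (_< x + d) (ℚ.+-identityʳ x) (ℚ.+-monoʳ-< x 0<d)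

<⇒≱ : ∀ {x y} → x < y → ¬ y ≤ x
<⇒≱ x<y y≤x = ℚ.<-irrefl refl (ℚ.<-≤-trans x<y y≤x)

0<y-x : ∀ {x y} → x < y → 0ℚ < y - x
0<y-x {x} {y} x<y = subst (_< y - x) (ℚ.+-inverseʳ x) (ℚ.+-monoˡ-< (ℚ.- x) x<y)

*-pos : ∀ {x y} → 0ℚ < x → 0ℚ < y → 0ℚ < x * y
*-pos {x} {y} 0<x 0<y =
  subst (_< x * y) (ℚ.*-zeroʳ x) (ℚ.*-monoʳ-<-pos x {{ℚ.positive 0<x}} 0<y)

+-pos : ∀ {x y} → 0ℚ < x → 0ℚ < y → 0ℚ < x + y
+-pos {x} {y} 0<x 0<y = ℚ.<-trans 0<x (x<x+d x 0<y)

*-mono-≤ : ∀ {a b c d} → 0ℚ ≤ a → a ≤ b → 0ℚ ≤ c → c ≤ d → a * c ≤ b * d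
*-mono-≤ {a} {b} {c} {d} 0≤a a≤b 0≤c c≤d = ℚ.≤-trans
  (ℚ.*-monoʳ-≤-nonNeg c {{ℚ.nonNegative 0≤c}} a≤b)
  (ℚ.*-monoˡ-≤-nonNeg b {{ℚ.nonNegative (ℚ.≤-trans 0≤a a≤b)}} c≤d)

*-mono-< : ∀ {a b c d} → 0ℚ < a → a < b → 0ℚ < c → c < d → a * c < b * d
*-mono-< {a} {b} {c} {d} 0<a a<b 0<c c<d = ℚ.<-trans
  (ℚ.*-monoˡ-<-pos c {{ℚ.positive 0<c}} a<b)
  (ℚ.*-monoʳ-<-pos b {{ℚ.positive (ℚ.<-trans 0<a a<b)}} c<d)

divide : ∀ x {y} → 0ℚ < y → ∃[ z ] z * y ≡ x
divide x {y} 0<y = x * y⁻¹ ,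
  trans (ℚ.*-assoc x y⁻¹ y) (trans (cong (x *_) (ℚ.*-inverseˡ y {{y≢0}})) (ℚ.*-identityʳ x))
  where
  y≢0 = ℚ.>-nonZero 0<y
  y⁻¹ = (ℚ.1/ y) {{y≢0}}

divide-pos : ∀ {x y} → 0ℚ < x → 0ℚ < y → ∃[ z ] 0ℚ < z × z * y ≡ x
divide-pos {x} {y} 0<x 0<y = let z , eq = divide x 0<y in
  z , ℚ.*-cancelʳ-<-nonNeg y {{ℚ.nonNegative (ℚ.<⇒≤ 0<y)}}
        (subst₂ _<_ (sym (ℚ.*-zeroˡ y)) (sym eq) 0<x) , eq

L<U : ∀ x {r s} → L x r → U x s → r < s
L<U x {r} {s} Lr Us with ℚ.<-cmp r s
... | tri< r<s _ _  = r<s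
... | tri≈ _ refl _ = contradiction Us (disjoint x Lr)
... | tri> _ _ s<r  = contradiction (U-up x s<r Us) (disjoint x Lr)

U-pos : ∀ x {s} → U x s → 0ℚ < s
U-pos x = L<U x (L-zero x)

L-pos : ∀ x → ∃[ a ] 0ℚ < a × L x a
L-pos x = L-open x (L-zero x)

approx : ∀ x {e} → 0ℚ < e → ∃[ a ] 0ℚ < a × L x a × U x (a + e)
approx x {e} 0<e with L-pos x | U-nonempty x
... | a , 0<a , La | B , UB = walk n a 0<a La (U-up x B<a+nδ UB)
  where
  δ = ℚ.½ * e
  0<δ = *-pos (ℚ.positive⁻¹ ℚ.½) 0<e
  q = proj₁ (divide B 0<δ)
  n = proj₁ (archimedean q)
  B<nδ : B < ι n * δ
  B<nδ = subst (_< ι n * δ) (proj₂ (divide B 0<δ))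
    (ℚ.*-monoˡ-<-pos δ {{ℚ.positive 0<δ}} (proj₂ (archimedean q)))
  B<a+nδ : B < a + ι n * δ
  B<a+nδ = ℚ.<-trans B<nδ (subst (ι n * δ <_) (ℚ.+-comm (ι n * δ) a) (x<x+d (ι n * δ) 0<a))
  step : ∀ a n → a + ι (suc n) * δ ≡ (a + δ) + ι n * δ
  step a n = trans (cong (λ z → a + z * δ) (ι-suc n))
    (S.solve 3 (λ a n δ → a S.:+ (S.con 1ℚ S.:+ n) S.:* δ S.:= (a S.:+ δ) S.:+ n S.:* δ)
      refl a (ι n) δ)
  halves : ∀ a → (a + δ) + δ ≡ a + e
  halves a = S.solve 2 (λ a e → (a S.:+ S.con ℚ.½ S.:* e) S.:+ S.con ℚ.½ S.:* e S.:= a S.:+ e)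
    refl a e
  walk : ∀ n a → 0ℚ < a → L x a → U x (a + ι n * δ) → ∃[ a ] 0ℚ < a × L x a × U x (a + e)
  walk zero a _ La Ua = contradiction
    (subst (U x) (trans (cong (λ z → a + z) (ℚ.*-zeroˡ δ)) (ℚ.+-identityʳ a)) Ua) (disjoint x La)
  walk (suc n) a 0<a La Ua with located x (x<x+d (a + δ) 0<δ)
  ... | inj₁ La+δ = walk n (a + δ) (+-pos 0<a 0<δ) La+δ (subst (U x) (step a n) Ua)
  ... | inj₂ Ua+2δ = a , 0<a , La , subst (U x) (halves a) Ua+2δ

-- The operation on ℝ⁺ induced by a strictly increasing operation on
-- the positive rationals, given arbitrarily close values at any two cuts.
lift₂ : (_∙_ : ℚ → ℚ → ℚ) →
  (∀ {a b} → 0ℚ < a → 0ℚ < b → 0ℚ < a ∙ b) →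
  (∀ {a a′ b b′} → 0ℚ < a → a < a′ → 0ℚ < b → b < b′ → (a ∙ b) < (a′ ∙ b′)) →
  (∀ x y {e} → 0ℚ < e → ∃[ a ] ∃[ b ] ∃[ a′ ] ∃[ b′ ]
    (0ℚ < a × L x a) × (0ℚ < b × L y b) × U x a′ × U y b′ × (a′ ∙ b′) < (a ∙ b) + e) →
  ℝ⁺ → ℝ⁺ → ℝ⁺
lift₂ _∙_ pos mono close x y = record
  { L = λ r → ∃[ a ] ∃[ b ] (0ℚ < a × L x a) × (0ℚ < b × L y b) × r < (a ∙ b)
  ; U = λ s → ∃[ a ] ∃[ b ] U x a × U y b × (a ∙ b) < s
  ; L-zero = let a , 0<a , La = L-pos x ; b , 0<b , Lb = L-pos y in
      a , b , (0<a , La) , (0<b , Lb) , pos 0<a 0<b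
  ; U-nonempty = let a , Ua = U-nonempty x ; b , Ub = U-nonempty y in
      (a ∙ b) + 1ℚ , a , b , Ua , Ub , x<x+d (a ∙ b) 0<1
  ; L-down = λ { r<s (a , b , La , Lb , s<ab) → a , b , La , Lb , ℚ.<-trans r<s s<ab }
  ; U-up = λ { r<s (a , b , Ua , Ub , ab<r) → a , b , Ua , Ub , ℚ.<-trans ab<r r<s }
  ; L-open = λ { (a , b , La , Lb , r<ab) → let s , r<s , s<ab = ℚ.<-dense r<ab in
      s , r<s , a , b , La , Lb , s<ab }
  ; U-open = λ { (a , b , Ua , Ub , ab<s) → let r , ab<r , r<s = ℚ.<-dense ab<s in
      r , r<s , a , b , Ua , Ub , ab<r }
  ; disjoint = λ { (a , b , (0<a , La) , (0<b , Lb) , r<ab) (a′ , b′ , Ua′ , Ub′ , a′b′<r) →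
      ℚ.<-asym (ℚ.<-trans a′b′<r r<ab) (mono 0<a (L<U x La Ua′) 0<b (L<U y Lb Ub′)) }
  ; located = loc
  }
  where
  loc : ∀ {r s} → r < s →
    (∃[ a ] ∃[ b ] (0ℚ < a × L x a) × (0ℚ < b × L y b) × r < (a ∙ b)) ⊎
    (∃[ a ] ∃[ b ] U x a × U y b × (a ∙ b) < s)
  loc {r} {s} r<s with close x y (0<y-x r<s)
  ... | a , b , a′ , b′ , La , Lb , Ua′ , Ub′ , bound with r ℚ.<? (a ∙ b)
  ...   | yes r<ab = inj₁ (a , b , La , Lb , r<ab)
  ...   | no  r≮ab = inj₂ (a′ , b′ , Ua′ , Ub′ , ℚ.<-≤-trans bound
            (subst ((a ∙ b) + (s - r) ≤_)
              (S.solve 2 (λ r s → r S.:+ (s S.:- r) S.:= s) refl r s)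
              (ℚ.+-monoˡ-≤ (s - r) (ℚ.≮⇒≥ r≮ab))))

+-close : ∀ x y {e} → 0ℚ < e → ∃[ a ] ∃[ b ] ∃[ a′ ] ∃[ b′ ]
  (0ℚ < a × L x a) × (0ℚ < b × L y b) × U x a′ × U y b′ × a′ + b′ < (a + b) + e
+-close x y {e} 0<e =
  let δ , 0<δ , δ<e = ℚ.<-dense 0<e
      a , 0<a , La , Ua′ = approx x (*-pos (ℚ.positive⁻¹ ℚ.½) 0<δ)
      b , 0<b , Lb , Ub′ = approx y (*-pos (ℚ.positive⁻¹ ℚ.½) 0<δ)
  in a , b , a + ℚ.½ * δ , b + ℚ.½ * δ , (0<a , La) , (0<b , Lb) , Ua′ , Ub′ ,
     subst (_< (a + b) + e)
       (S.solve 3 (λ a b δ → (a S.:+ b) S.:+ δ S.:=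
          (a S.:+ S.con ℚ.½ S.:* δ) S.:+ (b S.:+ S.con ℚ.½ S.:* δ)) refl a b δ)
       (ℚ.+-monoʳ-< (a + b) δ<e)

*-close : ∀ x y {e} → 0ℚ < e → ∃[ a ] ∃[ b ] ∃[ a′ ] ∃[ b′ ]
  (0ℚ < a × L x a) × (0ℚ < b × L y b) × U x a′ × U y b′ × a′ * b′ < (a * b) + e
*-close x y {e} 0<e =
  let A , UA = U-nonempty x
      B , UB = U-nonempty y
      0<1+e = +-pos 0<1 0<e
      0<A+B = +-pos (U-pos x UA) (U-pos y UB)
      M = (A + B) + (1ℚ + e)
      0<M = +-pos 0<A+B 0<1+e
      η , 0<η , η*M≡e = divide-pos 0<e 0<M
      e<M = ℚ.<-trans (subst (e <_) (ℚ.+-comm e 1ℚ) (x<x+d e 0<1))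
              (subst (1ℚ + e <_) (ℚ.+-comm (1ℚ + e) (A + B)) (x<x+d (1ℚ + e) 0<A+B))
      η<1 = ℚ.*-cancelʳ-<-nonNeg M {{ℚ.nonNegative (ℚ.<⇒≤ 0<M)}} {η} {1ℚ}
              (subst₂ _<_ (sym η*M≡e) (sym (ℚ.*-identityˡ M)) e<M)
      a , 0<a , La , Ua′ = approx x 0<η
      b , 0<b , Lb , Ub′ = approx y 0<η
  in a , b , a + η , b + η , (0<a , La) , (0<b , Lb) , Ua′ , Ub′ ,
     subst₂ _<_
       (S.solve 3 (λ a b η → (a S.:* b) S.:+ η S.:* (a S.:+ b S.:+ η) S.:=
          (a S.:+ η) S.:* (b S.:+ η)) refl a b η)
       (cong (λ z → a * b + z) η*M≡e)
       (ℚ.+-monoʳ-< (a * b) (ℚ.*-monoʳ-<-pos η {{ℚ.positive 0<η}}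
         (ℚ.+-mono-< (ℚ.+-mono-< (L<U x La UA) (L<U y Lb UB))
           (ℚ.<-trans η<1 (x<x+d 1ℚ 0<e)))))

infixl 6 _+ʳ_
infixl 7 _*ʳ_

_+ʳ_ : ℝ⁺ → ℝ⁺ → ℝ⁺
_+ʳ_ = lift₂ _+_ +-pos (λ _ a<a′ _ b<b′ → ℚ.+-mono-< a<a′ b<b′) +-close

_*ʳ_ : ℝ⁺ → ℝ⁺ → ℝ⁺
_*ʳ_ = lift₂ _*_ *-pos *-mono-< *-close

^-pos : ∀ {x} n → 0ℚ < x → 0ℚ < x ^ n
^-pos zero    _   = 0<1
^-pos (suc n) 0<x = *-pos 0<x (^-pos n 0<x)

^-mono-≤ : ∀ {x y} n → 0ℚ < x → x ≤ y → x ^ n ≤ y ^ n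
^-mono-≤ zero    _   _   = ℚ.≤-refl
^-mono-≤ (suc n) 0<x x≤y =
  *-mono-≤ (ℚ.<⇒≤ 0<x) x≤y (ℚ.<⇒≤ (^-pos n 0<x)) (^-mono-≤ n 0<x x≤y)

^-mono-< : ∀ {x y} n → 0ℚ < x → x < y → x ^ suc n < y ^ suc n
^-mono-< {x} {y} n 0<x x<y = ℚ.<-≤-trans
  (ℚ.*-monoˡ-<-pos (x ^ n) {{ℚ.positive (^-pos n 0<x)}} x<y)
  (ℚ.*-monoˡ-≤-nonNeg y {{ℚ.nonNegative (ℚ.<⇒≤ (ℚ.<-trans 0<x x<y))}}
    (^-mono-≤ n 0<x (ℚ.<⇒≤ x<y)))

1≤^ : ∀ {x} n → 1ℚ ≤ x → 1ℚ ≤ x ^ n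
1≤^ zero    _   = ℚ.≤-refl
1≤^ (suc n) 1≤x = *-mono-≤ 0≤1 1≤x 0≤1 (1≤^ n 1≤x)

^-monoʳ-≤ : ∀ {x m n} → 1ℚ ≤ x → m ℕ.≤ n → x ^ m ≤ x ^ n
^-monoʳ-≤ {n = n} 1≤x ℕ.z≤n = 1≤^ n 1≤x
^-monoʳ-≤ {x} 1≤x (ℕ.s≤s m≤n) =
  ℚ.*-monoˡ-≤-nonNeg x {{ℚ.nonNegative (ℚ.≤-trans 0≤1 1≤x)}} (^-monoʳ-≤ 1≤x m≤n)

1^ : ∀ n → 1ℚ ^ n ≡ 1ℚ
1^ zero    = refl
1^ (suc n) = trans (ℚ.*-identityˡ (1ℚ ^ n)) (1^ n)

bernoulli : ∀ {d} n → 0ℚ < d → 1ℚ + ι n * d ≤ (1ℚ + d) ^ n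
bernoulli {d} zero    _   = ℚ.≤-reflexive
  (trans (cong (λ z → 1ℚ + z) (ℚ.*-zeroˡ d)) (ℚ.+-identityʳ 1ℚ))
bernoulli {d} (suc n) 0<d = ℚ.≤-trans
  (subst₂ _≤_ (trans (ℚ.+-identityʳ _) (cong (λ z → 1ℚ + z * d) (sym (ι-suc n))))
     (S.solve 2 (λ n d → S.con 1ℚ S.:+ (S.con 1ℚ S.:+ n) S.:* d S.:+ (n S.:* d) S.:* d S.:=
        (S.con 1ℚ S.:+ d) S.:* (S.con 1ℚ S.:+ n S.:* d)) refl (ι n) d)
     (ℚ.+-monoʳ-≤ (1ℚ + (1ℚ + ι n) * d) 0≤ndd))
  (ℚ.*-monoˡ-≤-nonNeg (1ℚ + d) {{ℚ.nonNegative (ℚ.<⇒≤ (+-pos 0<1 0<d))}} (bernoulli n 0<d))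
  where
  0≤d = ℚ.<⇒≤ 0<d
  0≤ndd : 0ℚ ≤ (ι n * d) * d
  0≤ndd = *-mono-≤ {0ℚ} {ι n * d} {0ℚ} {d} ℚ.≤-refl
    (*-mono-≤ {0ℚ} {ι n} {0ℚ} {d} ℚ.≤-refl (ι-mono-≤ {0} {n} ℕ.z≤n) ℚ.≤-refl 0≤d) ℚ.≤-refl 0≤d

drop-/-< : ∀ p q p′ q′ → + p / suc q < + p′ / suc q′ → p ℕ.* suc q′ ℕ.< p′ ℕ.* suc q
drop-/-< p q p′ q′ lt = ℤ.drop‿+<+
  (subst₂ ℤ._<_ (sym (ℤ.pos-* p (suc q′))) (sym (ℤ.pos-* p′ (suc q)))
    (ℚᵘ.drop-*<*
      (ℚᵘ.<-respˡ-≃ (ℚ.toℚᵘ-fromℚᵘ (ℚᵘ.mkℚᵘ (+ p) q))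
      (ℚᵘ.<-respʳ-≃ (ℚ.toℚᵘ-fromℚᵘ (ℚᵘ.mkℚᵘ (+ p′) q′))
      (ℚ.toℚᵘ-mono-< lt)))))

/-+-1/ : ∀ p q n → + p / suc q + + 1 / suc n ≡ + (p ℕ.* suc n ℕ.+ suc q) / suc (n ℕ.+ q ℕ.* suc n)
/-+-1/ p q n = ℚ.toℚᵘ-injective
  (ℚᵘ.≃-trans (ℚ.toℚᵘ-homo-+ (+ p / suc q) (+ 1 / suc n))
  (ℚᵘ.≃-trans (ℚᵘ.+-cong (ℚ.toℚᵘ-fromℚᵘ (ℚᵘ.mkℚᵘ (+ p) q)) (ℚ.toℚᵘ-fromℚᵘ (ℚᵘ.mkℚᵘ (+ 1) n)))
  (ℚᵘ.≃-trans (ℚᵘ.*≡* (cong (ℤ._* + (suc q ℕ.* suc n))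
      (cong₂ ℤ._+_ (sym (ℤ.pos-* p (suc n))) (ℤ.*-identityˡ (+ suc q)))))
  (ℚᵘ.≃-sym (ℚ.toℚᵘ-fromℚᵘ (ℚᵘ.mkℚᵘ (+ (p ℕ.* suc n ℕ.+ suc q)) (n ℕ.+ q ℕ.* suc n)))))))

fraction : ∀ {r} → 0ℚ < r → ∃[ p ] ∃[ q ] r ≡ + p / suc q
fraction {r@(ℚ.mkℚ (+ p) q _)}    _   = p , q , sym (ℚ.↥p/↧p≡p r)
fraction {r@(ℚ.mkℚ -[1+ _ ] _ _)} 0<r = contradiction (ℚ.drop-*<* 0<r) λ { () }

b*m₁^n≤m₂^n : ∀ {b m₁ m₂} → 0ℚ < m₁ → m₁ < m₂ → ∃[ n ] b * m₁ ^ suc n ≤ m₂ ^ suc n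
b*m₁^n≤m₂^n {b} {m₁} {m₂} 0<m₁ m₁<m₂ =
  let d , 0<d , dm₁≡m₂-m₁ = divide-pos (0<y-x m₁<m₂) 0<m₁
      c , cd≡b = divide b 0<d
      n , c<n = archimedean c
      ι[1+n]d = subst (λ z → ι n * d ≤ z * d) (sym (ι-suc n))
        (ℚ.*-monoʳ-≤-nonNeg d {{ℚ.nonNegative (ℚ.<⇒≤ 0<d)}}
          (ℚ.<⇒≤ (subst (ι n <_) (ℚ.+-comm (ι n) 1ℚ) (x<x+d (ι n) 0<1))))
      b≤nd = subst (_≤ ι n * d) cd≡b
        (ℚ.*-monoʳ-≤-nonNeg d {{ℚ.nonNegative (ℚ.<⇒≤ 0<d)}} (ℚ.<⇒≤ c<n))
      nd≤1+nd = ℚ.<⇒≤ (subst (ι (suc n) * d <_) (ℚ.+-comm (ι (suc n) * d) 1ℚ)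
        (x<x+d (ι (suc n) * d) 0<1))
      b≤[1+d]^n = ℚ.≤-trans b≤nd (ℚ.≤-trans ι[1+n]d
        (ℚ.≤-trans nd≤1+nd (bernoulli (suc n) 0<d)))
      [1+d]m₁≡m₂ = trans (ℚ.*-distribʳ-+ m₁ 1ℚ d)
        (trans (cong₂ _+_ (ℚ.*-identityˡ m₁) dm₁≡m₂-m₁)
          (S.solve 2 (λ r s → r S.:+ (s S.:- r) S.:= s) refl m₁ m₂))
  in n , subst (b * m₁ ^ suc n ≤_)
       (trans (sym (Exp.^-distrib-* (1ℚ + d) m₁ (suc n))) (cong (_^ suc n) [1+d]m₁≡m₂))
       (ℚ.*-monoʳ-≤-nonNeg (m₁ ^ suc n)
         {{ℚ.nonNegative (ℚ.<⇒≤ (^-pos (suc n) 0<m₁))}} b≤[1+d]^n)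

module Power (β : ℚ) (1≤β : 1ℚ ≤ β) (α : ℝ⁺) where

  -- With q′ = suc q, Lower is the set of rationals below β ^ (p / q′) for
  -- some p / q′ < α, and Upper that of those above β ^ (p / q′) for some
  -- p / q′ > α; no roots are needed, as s ≤ β ^ (p / q′) amounts to
  -- s ^ q′ ≤ β ^ p for positive s.
  Lower Upper : Pred ℚ 0ℓ
  Lower r = ∃[ s ] ∃[ p ] ∃[ q ] r < s × 0ℚ < s × s ^ suc q ≤ β ^ p × L α (+ p / suc q)
  Upper r = ∃[ s ] ∃[ p ] ∃[ q ] s < r × 0ℚ < s × β ^ p ≤ s ^ suc q × U α (+ p / suc q)

  0<β : 0ℚ < β
  0<β = ℚ.<-≤-trans 0<1 1≤β

  below-1 : ∀ {r} → r < 1ℚ → Lower r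
  below-1 r<1 =
    let a , 0<a , La = L-pos α
        p , q , a≡p/q = fraction 0<a
    in 1ℚ , p , q , r<1 , 0<1 ,
       subst (_≤ β ^ p) (sym (1^ (suc q))) (1≤^ p 1≤β) , subst (L α) a≡p/q La

  nonempty : ∃ Upper
  nonempty =
    let a , Ua = U-nonempty α
        p , q , a≡p/q = fraction (U-pos α Ua)
        1≤β^p = 1≤^ p 1≤β
    in β ^ p + 1ℚ , β ^ p , p , q , x<x+d (β ^ p) 0<1 , ℚ.<-≤-trans 0<1 1≤β^p ,
       subst (_≤ (β ^ p) ^ suc q) (ℚ.*-identityʳ (β ^ p))
         (^-monoʳ-≤ {β ^ p} {1} {suc q} 1≤β^p (ℕ.s≤s ℕ.z≤n)) ,
       subst (U α) a≡p/q Ua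

  disj : ∀ {r} → Lower r → ¬ Upper r
  disj (s , p , q , r<s , 0<s , s^q≤β^p , La) (s′ , p′ , q′ , s′<r , 0<s′ , β^p′≤s′^q′ , Ua) =
    <⇒≱ (^-mono-< (q′ ℕ.+ q ℕ.* suc q′) 0<s′ (ℚ.<-trans s′<r r<s)) (begin
      s ^ (suc q ℕ.* suc q′)     ≡⟨ sym (Exp.^-assocʳ s (suc q) (suc q′)) ⟩
      (s ^ suc q) ^ suc q′       ≤⟨ ^-mono-≤ (suc q′) (^-pos (suc q) 0<s) s^q≤β^p ⟩
      (β ^ p) ^ suc q′           ≡⟨ Exp.^-assocʳ β p (suc q′) ⟩
      β ^ (p ℕ.* suc q′)         ≤⟨ ^-monoʳ-≤ 1≤β (ℕ.<⇒≤ (drop-/-< p q p′ q′ (L<U α La Ua))) ⟩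
      β ^ (p′ ℕ.* suc q)         ≡⟨ sym (Exp.^-assocʳ β p′ (suc q)) ⟩
      (β ^ p′) ^ suc q           ≤⟨ ^-mono-≤ (suc q) (^-pos p′ 0<β) β^p′≤s′^q′ ⟩
      (s′ ^ suc q′) ^ suc q      ≡⟨ Exp.^-assocʳ s′ (suc q′) (suc q) ⟩
      s′ ^ (suc q′ ℕ.* suc q)    ≡⟨ cong (s′ ^_) (ℕ.*-comm (suc q′) (suc q)) ⟩
      s′ ^ (suc q ℕ.* suc q′)    ∎)
    where open ℚ.≤-Reasoning

  bound : ∀ {m₁ m₂} p Q N → 0ℚ < m₁ → β ^ p ≤ m₁ ^ Q → β * m₁ ^ N ≤ m₂ ^ N →
          β ^ (p ℕ.* N ℕ.+ Q) ≤ m₂ ^ (Q ℕ.* N)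
  bound {m₁} {m₂} p Q N 0<m₁ β^p≤m₁^Q βm₁^N≤m₂^N = begin
    β ^ (p ℕ.* N ℕ.+ Q)       ≡⟨ Exp.^-homo-* β (p ℕ.* N) Q ⟩
    β ^ (p ℕ.* N) * β ^ Q     ≡⟨ cong (_* β ^ Q) (sym (Exp.^-assocʳ β p N)) ⟩
    (β ^ p) ^ N * β ^ Q       ≤⟨ ℚ.*-monoʳ-≤-nonNeg (β ^ Q) {{ℚ.nonNegative (ℚ.<⇒≤ (^-pos Q 0<β))}}
                                   (^-mono-≤ N (^-pos p 0<β) β^p≤m₁^Q) ⟩
    (m₁ ^ Q) ^ N * β ^ Q      ≡⟨ cong (_* β ^ Q) (Exp.^-assocʳ m₁ Q N) ⟩
    m₁ ^ (Q ℕ.* N) * β ^ Q    ≡⟨ cong (λ z → m₁ ^ z * β ^ Q) (ℕ.*-comm Q N) ⟩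
    m₁ ^ (N ℕ.* Q) * β ^ Q    ≡⟨ cong (_* β ^ Q) (sym (Exp.^-assocʳ m₁ N Q)) ⟩
    (m₁ ^ N) ^ Q * β ^ Q      ≡⟨ ℚ.*-comm ((m₁ ^ N) ^ Q) (β ^ Q) ⟩
    β ^ Q * (m₁ ^ N) ^ Q      ≡⟨ sym (Exp.^-distrib-* β (m₁ ^ N) Q) ⟩
    (β * m₁ ^ N) ^ Q          ≤⟨ ^-mono-≤ Q (*-pos 0<β (^-pos N 0<m₁)) βm₁^N≤m₂^N ⟩
    (m₂ ^ N) ^ Q              ≡⟨ Exp.^-assocʳ m₂ N Q ⟩
    m₂ ^ (N ℕ.* Q)            ≡⟨ cong (m₂ ^_) (ℕ.*-comm N Q) ⟩
    m₂ ^ (Q ℕ.* N)            ∎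
    where open ℚ.≤-Reasoning

  compare : ∀ {r s m₁ m₂} n p q → r < m₁ → 0ℚ < m₁ → m₁ < m₂ → m₂ < s →
            β * m₁ ^ suc n ≤ m₂ ^ suc n →
            L α (+ p / suc q) → U α (+ p / suc q + + 1 / suc n) → Lower r ⊎ Upper s
  compare {m₁ = m₁} {m₂} n p q r<m₁ 0<m₁ m₁<m₂ m₂<s βm₁^N≤m₂^N Lp Up =
    [ (λ m₁^Q≤β^p → inj₁ (m₁ , p , q , r<m₁ , 0<m₁ , m₁^Q≤β^p , Lp))
    , (λ β^p≤m₁^Q → inj₂ (m₂ , p ℕ.* suc n ℕ.+ suc q , n ℕ.+ q ℕ.* suc n , m₂<s ,
        ℚ.<-trans 0<m₁ m₁<m₂ , bound {m₁} {m₂} p (suc q) (suc n) 0<m₁ β^p≤m₁^Q βm₁^N≤m₂^N ,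
        subst (U α) (/-+-1/ p q n) Up))
    ] (ℚ.≤-total (m₁ ^ suc q) (β ^ p))

  approx-/ : ∀ n → ∃[ p ] ∃[ q ] L α (+ p / suc q) × U α (+ p / suc q + + 1 / suc n)
  approx-/ n = rewrite-fraction (approx α (ℚ.positive⁻¹ (+ 1 / suc n) {{ℚ.normalize-pos 1 (suc n)}}))
    where
    rewrite-fraction : ∀ {e} → ∃[ a ] 0ℚ < a × L α a × U α (a + e) →
      ∃[ p ] ∃[ q ] L α (+ p / suc q) × U α (+ p / suc q + e)
    rewrite-fraction {e} (a , 0<a , La , Ua) = let p , q , a≡p/q = fraction 0<a in
      p , q , subst (L α) a≡p/q La , subst (λ z → U α (z + e)) a≡p/q Ua

  loc-above-1 : ∀ {r s} → 1ℚ ≤ r → r < s → Lower r ⊎ Upper s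
  loc-above-1 {r} {s} 1≤r r<s = choose-m₁ (ℚ.<-dense r<s)
    where
    choose-p/q : ∀ {m₁ m₂} → r < m₁ → 0ℚ < m₁ → m₁ < m₂ → m₂ < s →
      ∃[ n ] β * m₁ ^ suc n ≤ m₂ ^ suc n → Lower r ⊎ Upper s
    choose-p/q r<m₁ 0<m₁ m₁<m₂ m₂<s (n , βm₁^N≤m₂^N) =
      let p , q , Lp , Up = approx-/ n in
      compare n p q r<m₁ 0<m₁ m₁<m₂ m₂<s βm₁^N≤m₂^N Lp Up

    choose-m₂ : ∀ {m₁} → r < m₁ → ∃[ m₂ ] m₁ < m₂ × m₂ < s → Lower r ⊎ Upper s
    choose-m₂ r<m₁ (m₂ , m₁<m₂ , m₂<s) =
      choose-p/q r<m₁ 0<m₁ m₁<m₂ m₂<s (b*m₁^n≤m₂^n {β} 0<m₁ m₁<m₂)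
      where 0<m₁ = ℚ.<-trans (ℚ.<-≤-trans 0<1 1≤r) r<m₁

    choose-m₁ : ∃[ m₁ ] r < m₁ × m₁ < s → Lower r ⊎ Upper s
    choose-m₁ (m₁ , r<m₁ , m₁<s) = choose-m₂ r<m₁ (ℚ.<-dense m₁<s)

  loc : ∀ {r s} → r < s → Lower r ⊎ Upper s
  loc {r} r<s with r ℚ.<? 1ℚ
  ... | yes r<1 = inj₁ (below-1 r<1)
  ... | no  r≮1 = loc-above-1 (ℚ.≮⇒≥ r≮1) r<s

infixr 8 _^ʳ_

_^ʳ_ : (b : ℕ) → .{{ℕ.NonZero b}} → ℝ⁺ → ℝ⁺
b ^ʳ α = record
  { L = Lower
  ; U = Upper
  ; L-zero = below-1 0<1
  ; U-nonempty = nonempty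
  ; L-down = λ { r<r′ (s , p , q , r′<s , rest) → s , p , q , ℚ.<-trans r<r′ r′<s , rest }
  ; U-up = λ { r<r′ (s , p , q , s<r , rest) → s , p , q , ℚ.<-trans s<r r<r′ , rest }
  ; L-open = λ { (s , p , q , r<s , rest) → let r′ , r<r′ , r′<s = ℚ.<-dense r<s in
      r′ , r<r′ , s , p , q , r′<s , rest }
  ; U-open = λ { (s , p , q , s<r , rest) → let r′ , s<r′ , r′<r = ℚ.<-dense s<r in
      r′ , r′<r , s , p , q , s<r′ , rest }
  ; disjoint = disj
  ; located = loc
  }
  where open Power (+ b / 1) (ι-mono-≤ {1} {b} (ℕ.>-nonZero⁻¹ b)) α

{-# OPTIONS --safe #-}

-- In an equinumerous t-coloring of N = tn points, a pair x < y of one color lies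
-- in at most k τ(y − x) progressions, where τ(m) counts the divisors of m that
-- are at most k.  As τ is submultiplicative, τ(m) ^ 6 is at most the number of
-- 63-tuples of integers ≤ k whose product divides m, so that the sum of τ ^ 6
-- over m ≤ N is N times a power of log k.  By τ M ^ 5 ≤ M ^ 6 + τ ^ 6, a class of
-- n points gives Σ τ(y − x) ≤ n M + N polylog(k) / M ^ 5 for each x, and with M of
-- order √k and t = 16 k² M fewer progressions contain a monochromatic pair than
-- there are progressions.  Since T_k is minimal, forcing a rainbow AP(k) for this
-- one t of order k ^ (5/2) suffices.
module Submission where

open import Defs
open import Data.Nat.Base
  using (ℕ; NonZero; _≤_; _<_; zero; suc; pred; _+_; _*_; _∸_; _^_; z≤n; s≤s; z<s; s<s; s<s⁻¹;
         >-nonZero; >-nonZero⁻¹)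
open import Data.Integer.Base using (+_)
open import Data.Rational.Base using (_/_; 0ℚ; 1ℚ)
open import Data.Product using (∃-syntax; _×_; _,_)
open import Algebra.Bundles using (CommutativeRing)
import Data.Nat.DivMod as ℕ
import Data.Nat.Properties as ℕ
import Data.Rational.Base as ℚ
import Data.Rational.Properties as ℚ
open import Algebra.Definitions.RawSemiring ℚ.+-*-rawSemiring using () renaming (_^_ to _^ℚ_)
import Algebra.Properties.CommutativeSemiring.Exp
  (CommutativeRing.commutativeSemiring ℚ.+-*-commutativeRing) as Exp
open import Data.Bool.Base using (true; false)
open import Data.Fin.Base using (Fin; toℕ; fromℕ<)
import Data.Fin.Base as Fin
import Data.Fin.Properties as Fin
open import Data.List.Base using (length; filter; tabulate)
open import Data.Nat.Divisibility
  using (_∣_; _∣?_; divides; ∣-trans; ∣⇒≤; m∣m*n; n∣m*n; *-cancelʳ-∣; m*n∣o⇒n∣o/m)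
open import Data.Nat.GCD using (gcd; gcd-greatest; gcd[m,n]∣m; gcd[m,n]∣n; c*gcd[m,n]≡gcd[cm,cn])
open import Data.Nat.Solver using (module +-*-Solver)
open import Data.Sum using (_⊎_; inj₁; inj₂; [_,_]′)
open import Function.Base using (_∘_; id)
open import Relation.Binary.Definitions using (tri<; tri≈; tri>)
open import Relation.Binary.PropositionalEquality hiding ([_])
open import Relation.Nullary using (¬_; Dec; _because_; yes; no; does; contradiction)

-- Finite sums over initial segments of the naturals.

∑ : ℕ → (ℕ → ℕ) → ℕ
∑ zero    f = 0
∑ (suc n) f = f 0 + ∑ n (f ∘ suc)

syntax ∑ n (λ i → e) = ∑[ i < n ] e

∑-mono : ∀ n {f g} → (∀ {i} → i < n → f i ≤ g i) → ∑ n f ≤ ∑ n g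
∑-mono zero    f≤g = z≤n
∑-mono (suc n) f≤g = ℕ.+-mono-≤ (f≤g z<s) (∑-mono n (f≤g ∘ s<s))

∑-mono-all : ∀ n {f g} → (∀ i → f i ≤ g i) → ∑ n f ≤ ∑ n g
∑-mono-all n f≤g = ∑-mono n λ {i} _ → f≤g i

∑-cong : ∀ n {f g} → (∀ i → f i ≡ g i) → ∑ n f ≡ ∑ n g
∑-cong zero    f≗g = refl
∑-cong (suc n) f≗g = cong₂ _+_ (f≗g 0) (∑-cong n (f≗g ∘ suc))

∑-distrib-+ : ∀ n f g → ∑[ i < n ] (f i + g i) ≡ ∑ n f + ∑ n g
∑-distrib-+ zero    f g = refl
∑-distrib-+ (suc n) f g = trans
  (cong (_+_ (f 0 + g 0)) (∑-distrib-+ n (f ∘ suc) (g ∘ suc)))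
  (interchange (f 0) (g 0) (∑ n (f ∘ suc)) (∑ n (g ∘ suc)))
  where open import Algebra.Properties.CommutativeSemigroup ℕ.+-commutativeSemigroup

∑-distrib-* : ∀ n c f → ∑[ i < n ] (c * f i) ≡ c * ∑ n f
∑-distrib-* zero    c f = sym (ℕ.*-zeroʳ c)
∑-distrib-* (suc n) c f =
  trans (cong (_+_ (c * f 0)) (∑-distrib-* n c (f ∘ suc))) (sym (ℕ.*-distribˡ-+ c (f 0) _))

∑-distrib-*ʳ : ∀ n f c → ∑[ i < n ] (f i * c) ≡ ∑ n f * c
∑-distrib-*ʳ n f c =
  trans (∑-cong n (λ i → ℕ.*-comm (f i) c)) (trans (∑-distrib-* n c f) (ℕ.*-comm c (∑ n f)))

∑-const : ∀ n c → ∑[ i < n ] c ≡ n * c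
∑-const zero    c = refl
∑-const (suc n) c = cong (_+_ c) (∑-const n c)

∑-bound : ∀ n {f c} → (∀ {i} → i < n → f i ≤ c) → ∑ n f ≤ n * c
∑-bound n {f} {c} f≤c = ℕ.≤-trans (∑-mono n f≤c) (ℕ.≤-reflexive (∑-const n c))

∑-swap : ∀ m n (f : ℕ → ℕ → ℕ) →
  (∑[ i < m ] ∑[ j < n ] f i j) ≡ (∑[ j < n ] ∑[ i < m ] f i j)
∑-swap zero    n f = sym (trans (∑-const n 0) (ℕ.*-zeroʳ n))
∑-swap (suc m) n f = trans (cong (_+_ (∑ n (f 0))) (∑-swap m n (f ∘ suc)))
  (sym (∑-distrib-+ n (f 0) _))

∑-split : ∀ m n f → ∑ (m + n) f ≡ ∑ m f + ∑[ i < n ] f (m + i)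
∑-split zero    n f = refl
∑-split (suc m) n f = trans (cong (_+_ (f 0)) (∑-split m n (f ∘ suc))) (sym (ℕ.+-assoc (f 0) _ _))

∑-monoˡ : ∀ {m n} f → m ≤ n → ∑ m f ≤ ∑ n f
∑-monoˡ f z≤n       = z≤n
∑-monoˡ f (s≤s m≤n) = ℕ.+-monoʳ-≤ (f 0) (∑-monoˡ (f ∘ suc) m≤n)

term≤∑ : ∀ {n i} f → i < n → f i ≤ ∑ n f
term≤∑ {suc n} {zero}  f _   = ℕ.m≤m+n (f 0) _
term≤∑ {suc n} {suc i} f i<n = ℕ.≤-trans (term≤∑ (f ∘ suc) (s<s⁻¹ i<n)) (ℕ.m≤n+m _ (f 0))

∑-shift : ∀ {m n} s f → s + m ≤ n → ∑[ i < m ] f (s + i) ≤ ∑ n f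
∑-shift {m} s f s+m≤n = ℕ.≤-trans
  (ℕ.≤-trans (ℕ.m≤n+m _ (∑ s f)) (ℕ.≤-reflexive (sym (∑-split s m f))))
  (∑-monoˡ f s+m≤n)

∑-small-term : ∀ n {f c} → ∑ n f < n * c → ∃[ i ] i < n × f i < c
∑-small-term (suc n) {f} {c} ∑<nc with f 0 ℕ.<? c
... | yes f0<c = 0 , z<s , f0<c
... | no  f0≮c =
  let i , i<n , fi<c = ∑-small-term n (ℕ.+-cancelˡ-< c _ _
        (ℕ.≤-<-trans (ℕ.+-monoˡ-≤ _ (ℕ.≮⇒≥ f0≮c)) ∑<nc))
  in suc i , s<s i<n , fi<c

-- Indicators and reindexing of sums.

χ : {P : Set} → Dec P → ℕ
χ (true  because _) = 1
χ (false because _) = 0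

-- Serves decisions such as `suc v ≟ suc i` and `v ≟ i`, whose booleans agree by computation while
-- their proofs differ.
χ-does : ∀ {P Q : Set} (P? : Dec P) (Q? : Dec Q) → does P? ≡ does Q? → χ P? ≡ χ Q?
χ-does (true  because _) (true  because _) _ = refl
χ-does (false because _) (false because _) _ = refl

χ-true : ∀ {P : Set} (P? : Dec P) → P → χ P? ≡ 1
χ-true (yes _) p = refl
χ-true (no ¬p) p = contradiction p ¬p

χ-false : ∀ {P : Set} (P? : Dec P) → ¬ P → χ P? ≡ 0
χ-false (yes p) ¬p = contradiction p ¬p
χ-false (no  _) ¬p = refl

χ≤1 : ∀ {P : Set} (P? : Dec P) → χ P? ≤ 1
χ≤1 (yes _) = ℕ.≤-refl
χ≤1 (no  _) = z≤n

∑-χ≟ : ∀ n v c → ∑[ i < n ] (χ (v ℕ.≟ i) * c) ≤ c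
∑-χ≟ zero    v       c = z≤n
∑-χ≟ (suc n) zero    c = ℕ.≤-reflexive
  (trans (cong (_+_ (c + 0)) (trans (∑-const n 0) (ℕ.*-zeroʳ n)))
    (trans (ℕ.+-identityʳ (c + 0)) (ℕ.+-identityʳ c)))
∑-χ≟ (suc n) (suc v) c = ℕ.≤-trans
  (ℕ.≤-reflexive (∑-cong n λ i → cong (_* c) (χ-does (suc v ℕ.≟ suc i) (v ℕ.≟ i) refl)))
  (∑-χ≟ n v c)

-- Each index `i` with `f i` nonzero is charged to some `j` with `φ j ≡ i`. As `φ` is a function, no
-- `j` is charged twice, so the choice of `j` needs no separate injectivity proof.
∑-reindex : ∀ m n {f g} (φ : ℕ → ℕ) →
  (∀ {i} → i < m → f i ≤ 0 ⊎ ∃[ j ] j < n × φ j ≡ i × f i ≤ g j) →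
  ∑ m f ≤ ∑ n g
∑-reindex m n {f} {g} φ hit = begin
  ∑ m f                                       ≤⟨ ∑-mono m pick ⟩
  ∑[ i < m ] ∑[ j < n ] (χ (φ j ℕ.≟ i) * g j) ≡⟨ ∑-swap m n _ ⟩
  ∑[ j < n ] ∑[ i < m ] (χ (φ j ℕ.≟ i) * g j) ≤⟨ ∑-mono-all n (λ j → ∑-χ≟ m (φ j) (g j)) ⟩
  ∑ n g                                       ∎
  where
  open ℕ.≤-Reasoning
  pick : ∀ {i} → i < m → f i ≤ ∑[ j < n ] (χ (φ j ℕ.≟ i) * g j)
  pick {i} i<m with hit i<m
  ... | inj₁ fi≤0 = ℕ.≤-trans fi≤0 z≤n
  ... | inj₂ (j , j<n , φj≡i , fi≤gj) = begin
    f i                               ≤⟨ fi≤gj ⟩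
    g j                               ≡⟨ ℕ.*-identityˡ (g j) ⟨
    1 * g j                           ≡⟨ cong (_* g j) (χ-true (φ j ℕ.≟ i) φj≡i) ⟨
    χ (φ j ℕ.≟ i) * g j               ≤⟨ term≤∑ (λ j → χ (φ j ℕ.≟ i) * g j) j<n ⟩
    ∑[ j < n ] (χ (φ j ℕ.≟ i) * g j)  ∎

-- Moments of the divisor function truncated at `k`.

module Divisors (k : ℕ) where

  -- Indices start at 0: d stands for the divisor suc d ≤ k.
  τ : ℕ → ℕ
  τ m = ∑[ d < k ] χ (suc d ∣? m)

  -- The number of r-tuples of elements of {1, …, k} whose product divides m.
  τ^ : ℕ → ℕ → ℕ
  τ^ zero    m = 1
  τ^ (suc r) m = ∑[ d < k ] (χ (suc d ∣? m) * τ^ r (m ℕ./ suc d))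

  quotient< : ∀ {d q e} → d < k → suc d ≡ suc q * suc e → q < k
  quotient< {q = q} {e} d<k eq =
    ℕ.≤-trans (ℕ.≤-trans (ℕ.m≤m*n (suc q) (suc e)) (ℕ.≤-reflexive (sym eq))) d<k

  -- A divisor d of a b is recovered from e = gcd d a, which divides a, and f = d / e, which divides
  -- b because d divides gcd (b d) (b a) = b e.
  τ-submultiplicative : ∀ a b → τ (a * b) ≤ τ a * τ b
  τ-submultiplicative a b = begin
    ∑[ d < k ] χ (suc d ∣? a * b)
      ≤⟨ ∑-mono k classify ⟩
    ∑[ d < k ] ∑[ e < k ] (χ (gcd (suc d) a ℕ.≟ suc e) * χ (suc d ∣? a * b))
      ≡⟨ ∑-swap k k _ ⟩
    ∑[ e < k ] ∑[ d < k ] (χ (gcd (suc d) a ℕ.≟ suc e) * χ (suc d ∣? a * b))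
      ≤⟨ ∑-mono-all k fibre ⟩
    ∑[ e < k ] (χ (suc e ∣? a) * τ b)
      ≡⟨ ∑-distrib-*ʳ k _ (τ b) ⟩
    τ a * τ b ∎
    where
    open ℕ.≤-Reasoning
    classify : ∀ {d} → d < k → χ (suc d ∣? a * b) ≤
      ∑[ e < k ] (χ (gcd (suc d) a ℕ.≟ suc e) * χ (suc d ∣? a * b))
    classify {d} d<k with gcd (suc d) a in eq | gcd[m,n]∣m (suc d) a
    ... | zero  | divides q d≡0 = contradiction (trans d≡0 (ℕ.*-zeroʳ q)) λ ()
    ... | suc e | e∣d = ℕ.≤-trans
      (ℕ.≤-reflexive (trans (sym (ℕ.*-identityˡ _))
        (cong (_* χ (suc d ∣? a * b)) (sym (χ-true (suc e ℕ.≟ suc e) refl)))))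
      (term≤∑ (λ e′ → χ (suc e ℕ.≟ suc e′) * χ (suc d ∣? a * b)) (ℕ.≤-trans (∣⇒≤ e∣d) d<k))
    fibre : ∀ e → ∑[ d < k ] (χ (gcd (suc d) a ℕ.≟ suc e) * χ (suc d ∣? a * b))
      ≤ χ (suc e ∣? a) * τ b
    fibre e with suc e ∣? a
    ... | no e∤a = ℕ.≤-trans (∑-bound k λ {d} _ → vanish d) (ℕ.≤-reflexive (ℕ.*-zeroʳ k))
      where
      vanish : ∀ d → χ (gcd (suc d) a ℕ.≟ suc e) * χ (suc d ∣? a * b) ≤ 0
      vanish d with gcd (suc d) a ℕ.≟ suc e
      ... | yes eq = contradiction (subst (_∣ a) eq (gcd[m,n]∣n (suc d) a)) e∤a
      ... | no  _  = z≤n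
    -- `f + e * suc f` is the predecessor of `suc e * suc f`, that is, the index of the product.
    ... | yes _ = ℕ.≤-trans (∑-reindex k k (λ f → f + e * suc f) hit)
      (ℕ.≤-reflexive (sym (ℕ.*-identityˡ (τ b))))
      where
      hit : ∀ {d} → d < k → χ (gcd (suc d) a ℕ.≟ suc e) * χ (suc d ∣? a * b) ≤ 0 ⊎
        ∃[ f ] f < k × f + e * suc f ≡ d ×
        χ (gcd (suc d) a ℕ.≟ suc e) * χ (suc d ∣? a * b) ≤ χ (suc f ∣? b)
      hit {d} d<k with gcd (suc d) a ℕ.≟ suc e | suc d ∣? a * b
      ... | no _   | _      = inj₁ z≤n
      ... | yes _  | no _   = inj₁ z≤n
      ... | yes eq | yes d∣ab with subst (_∣ suc d) eq (gcd[m,n]∣m (suc d) a)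
      ...   | divides (suc f) d≡fe = inj₂
        (f , quotient< d<k d≡fe
        , ℕ.suc-injective (trans (ℕ.*-comm (suc e) (suc f)) (sym d≡fe))
        , ℕ.≤-reflexive (sym (χ-true (suc f ∣? b) (*-cancelʳ-∣ (suc e) (subst₂ _∣_ d≡fe
            (trans (sym (c*gcd[m,n]≡gcd[cm,cn] b (suc d) a)) (cong (b *_) eq))
            (gcd-greatest (n∣m*n b) (subst (suc d ∣_) (ℕ.*-comm a b) d∣ab)))))))

  -- Recursive, so that `τ^ (2r+1 (suc r))` unfolds into two nested divisor sums by computation.
  2r+1 : ℕ → ℕ
  2r+1 zero    = 1
  2r+1 (suc r) = suc (suc (2r+1 r))

  -- For d ∣ m, τ m ≤ τ d * τ (m / d), and τ d expands into the factorisations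
  -- d = e f, which trade the single factor d for the two factors e and f.
  τ^*τ≤τ^ : ∀ r m → τ^ r m * τ m ≤ τ^ (2r+1 r) m
  τ^*τ≤τ^ zero    m = ℕ.≤-reflexive
    (trans (ℕ.*-identityˡ (τ m)) (∑-cong k (λ d → sym (ℕ.*-identityʳ _))))
  τ^*τ≤τ^ (suc r) m = begin
    τ^ (suc r) m * τ m
      ≡⟨ ∑-distrib-*ʳ k _ (τ m) ⟨
    ∑[ d < k ] (χ (suc d ∣? m) * τ^ r (m ℕ./ suc d) * τ m)
      ≤⟨ ∑-mono-all k expand ⟩
    ∑[ d < k ] ∑[ e < k ] (χ (suc e ∣? suc d) * (χ (suc d ∣? m) * G (m ℕ./ suc d)))
      ≡⟨ ∑-swap k k _ ⟩
    ∑[ e < k ] ∑[ d < k ] (χ (suc e ∣? suc d) * (χ (suc d ∣? m) * G (m ℕ./ suc d)))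
      ≤⟨ ∑-mono-all k fibre ⟩
    τ^ (2r+1 (suc r)) m ∎
    where
    open ℕ.≤-Reasoning
    G = τ^ (2r+1 r)
    expand : ∀ d → χ (suc d ∣? m) * τ^ r (m ℕ./ suc d) * τ m ≤
      ∑[ e < k ] (χ (suc e ∣? suc d) * (χ (suc d ∣? m) * G (m ℕ./ suc d)))
    expand d with suc d ∣? m
    ... | no _ = z≤n
    ... | yes d∣m = begin
      1 * τ^ r q * τ m              ≡⟨ cong (_* τ m) (ℕ.*-identityˡ (τ^ r q)) ⟩
      τ^ r q * τ m                  ≡⟨ cong (λ z → τ^ r q * τ z) (ℕ.m/n*n≡m d∣m) ⟨
      τ^ r q * τ (q * suc d)        ≤⟨ ℕ.*-monoʳ-≤ (τ^ r q) (τ-submultiplicative q (suc d)) ⟩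
      τ^ r q * (τ q * τ (suc d))    ≡⟨ ℕ.*-assoc (τ^ r q) _ _ ⟨
      τ^ r q * τ q * τ (suc d)      ≤⟨ ℕ.*-monoˡ-≤ (τ (suc d)) (τ^*τ≤τ^ r q) ⟩
      G q * τ (suc d)               ≡⟨ ℕ.*-comm (G q) _ ⟩
      τ (suc d) * G q               ≡⟨ cong (τ (suc d) *_) (ℕ.*-identityˡ (G q)) ⟨
      τ (suc d) * (1 * G q)         ≡⟨ ∑-distrib-*ʳ k _ (1 * G q) ⟨
      ∑[ e < k ] (χ (suc e ∣? suc d) * (1 * G q)) ∎
      where q = m ℕ./ suc d
    fibre : ∀ e → ∑[ d < k ] (χ (suc e ∣? suc d) * (χ (suc d ∣? m) * G (m ℕ./ suc d))) ≤
      χ (suc e ∣? m) * ∑[ f < k ] (χ (suc f ∣? m ℕ./ suc e) * G (m ℕ./ suc e ℕ./ suc f))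
    fibre e with suc e ∣? m
    ... | no e∤m = ℕ.≤-trans (∑-bound k λ {d} _ → vanish d) (ℕ.≤-reflexive (ℕ.*-zeroʳ k))
      where
      vanish : ∀ d → χ (suc e ∣? suc d) * (χ (suc d ∣? m) * G (m ℕ./ suc d)) ≤ 0
      vanish d with suc e ∣? suc d | suc d ∣? m
      ... | yes e∣d | yes d∣m = contradiction (∣-trans e∣d d∣m) e∤m
      ... | yes _   | no  _   = z≤n
      ... | no  _   | _       = z≤n
    ... | yes _ = ℕ.≤-trans (∑-reindex k k (λ f → f + e * suc f) hit)
      (ℕ.≤-reflexive (sym (ℕ.*-identityˡ _)))
      where
      hit : ∀ {d} → d < k →
        χ (suc e ∣? suc d) * (χ (suc d ∣? m) * G (m ℕ./ suc d)) ≤ 0 ⊎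
        ∃[ f ] f < k × f + e * suc f ≡ d ×
        χ (suc e ∣? suc d) * (χ (suc d ∣? m) * G (m ℕ./ suc d)) ≤
        χ (suc f ∣? m ℕ./ suc e) * G (m ℕ./ suc e ℕ./ suc f)
      hit {d} d<k with suc e ∣? suc d | suc d ∣? m
      ... | no _  | _    = inj₁ z≤n
      ... | yes _ | no _ = inj₁ z≤n
      ... | yes (divides (suc f) d≡fe) | yes d∣m = inj₂
        (f , quotient< d<k d≡fe , ℕ.suc-injective (sym d≡ef) , ℕ.≤-reflexive (begin-equality
          1 * (1 * G (m ℕ./ suc d))
            ≡⟨ ℕ.*-identityˡ _ ⟩
          1 * G (m ℕ./ suc d)
            ≡⟨ cong₂ (λ x y → x * G y) (χ-true (suc f ∣? m ℕ./ suc e) f∣m/e) m/e/f ⟨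
          χ (suc f ∣? m ℕ./ suc e) * G (m ℕ./ suc e ℕ./ suc f) ∎))
        where
        d≡ef : suc d ≡ suc e * suc f
        d≡ef = trans d≡fe (ℕ.*-comm (suc f) (suc e))
        f∣m/e : suc f ∣ m ℕ./ suc e
        f∣m/e = m*n∣o⇒n∣o/m (suc e) (suc f) (subst (_∣ m) d≡ef d∣m)
        m/e/f : m ℕ./ suc e ℕ./ suc f ≡ m ℕ./ suc d
        m/e/f = trans (ℕ.m/n/o≡m/[n*o] m (suc e) (suc f)) (ℕ./-congʳ {m = m} (sym d≡ef))

  -- order p = 2 ^ p − 1.
  order : ℕ → ℕ
  order zero    = 0
  order (suc p) = 2r+1 (order p)

  τ-power : ∀ p m → τ m ^ p ≤ τ^ (order p) m
  τ-power zero    m = ℕ.≤-refl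
  τ-power (suc p) m = begin
    τ m * τ m ^ p            ≤⟨ ℕ.*-monoʳ-≤ (τ m) (τ-power p m) ⟩
    τ m * τ^ (order p) m     ≡⟨ ℕ.*-comm (τ m) _ ⟩
    τ^ (order p) m * τ m     ≤⟨ τ^*τ≤τ^ (order p) m ⟩
    τ^ (order (suc p)) m     ∎
    where open ℕ.≤-Reasoning

  -- Fixing the first divisor d leaves m = d q with q at most n / d. The induction hypothesis at n /
  -- d bounds the inner sum, and summing n / d over d costs one more factor `h`.
  ∑-τ^ : ∀ {h} → (∀ n → ∑[ d < k ] (n ℕ./ suc d) ≤ h * n) →
    ∀ r n → ∑[ m < n ] τ^ r (suc m) ≤ h ^ r * n
  ∑-τ^ {h} harmonic zero n =
    ℕ.≤-reflexive (trans (∑-const n 1) (ℕ.*-comm n 1))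
  ∑-τ^ {h} harmonic (suc r) n = begin
    ∑[ m < n ] ∑[ d < k ] (χ (suc d ∣? suc m) * τ^ r (suc m ℕ./ suc d))
      ≡⟨ ∑-swap n k _ ⟩
    ∑[ d < k ] ∑[ m < n ] (χ (suc d ∣? suc m) * τ^ r (suc m ℕ./ suc d))
      ≤⟨ ∑-mono-all k (λ d → ∑-reindex n (n ℕ./ suc d) (λ q → d + q * suc d) (hit d)) ⟩
    ∑[ d < k ] ∑[ q < n ℕ./ suc d ] τ^ r (suc q)
      ≤⟨ ∑-mono-all k (λ d → ∑-τ^ {h} harmonic r (n ℕ./ suc d)) ⟩
    ∑[ d < k ] (h ^ r * (n ℕ./ suc d))
      ≡⟨ ∑-distrib-* k (h ^ r) _ ⟩
    h ^ r * ∑[ d < k ] (n ℕ./ suc d)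
      ≤⟨ ℕ.*-monoʳ-≤ (h ^ r) (harmonic n) ⟩
    h ^ r * (h * n)
      ≡⟨ ℕ.*-assoc (h ^ r) h n ⟨
    h ^ r * h * n
      ≡⟨ cong (_* n) (ℕ.*-comm (h ^ r) h) ⟩
    h ^ suc r * n ∎
    where
    open ℕ.≤-Reasoning
    hit : ∀ d {m} → m < n → χ (suc d ∣? suc m) * τ^ r (suc m ℕ./ suc d) ≤ 0 ⊎
      ∃[ q ] q < n ℕ./ suc d × d + q * suc d ≡ m ×
      χ (suc d ∣? suc m) * τ^ r (suc m ℕ./ suc d) ≤ τ^ r (suc q)
    hit d {m} m<n with suc d ∣? suc m
    ... | no _ = inj₁ z≤n
    ... | yes (divides (suc q) m≡qd) = inj₂
      (q , ℕ.≤-trans (ℕ.≤-reflexive (sym m/d)) (ℕ./-monoˡ-≤ (suc d) m<n)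
      , ℕ.suc-injective (sym m≡qd)
      , ℕ.≤-reflexive (trans (ℕ.*-identityˡ _) (cong (τ^ r) m/d)))
      where
      m/d : suc m ℕ./ suc d ≡ suc q
      m/d = trans (ℕ./-congˡ {o = suc d} m≡qd) (ℕ.m*n/n≡m (suc q) (suc d))

-- Dyadic blocks: passing from 2 ^ h - 1 to 2 ^ (h + 1) - 1 divisors adds 2 ^ h terms, each at most
-- n / 2 ^ h, hence at most n in all.
harmonic : ∀ h n → ∑[ d < pred (2 ^ h) ] (n ℕ./ suc d) ≤ h * n
harmonic zero    n = z≤n
harmonic (suc h) n = begin
  ∑[ d < pred (2 ^ suc h) ] (n ℕ./ suc d)
    ≡⟨ cong (λ m → ∑[ d < pred m ] (n ℕ./ suc d))
         (trans (cong (_+_ (2 ^ h)) (ℕ.+-identityʳ (2 ^ h))) (cong₂ _+_ 2^h 2^h)) ⟩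
  ∑[ d < b + suc b ] (n ℕ./ suc d)
    ≡⟨ ∑-split b (suc b) _ ⟩
  ∑[ d < b ] (n ℕ./ suc d) + ∑[ d < suc b ] (n ℕ./ suc (b + d))
    ≤⟨ ℕ.+-mono-≤ (harmonic h n) block ⟩
  h * n + n
    ≡⟨ ℕ.+-comm (h * n) n ⟩
  suc h * n ∎
  where
  open ℕ.≤-Reasoning
  b = pred (2 ^ h)
  2^h : 2 ^ h ≡ suc b
  2^h = sym (ℕ.suc-pred (2 ^ h) {{ℕ.m^n≢0 2 h}})
  block : ∑[ d < suc b ] (n ℕ./ suc (b + d)) ≤ n
  block = begin
    ∑[ d < suc b ] (n ℕ./ suc (b + d))
      ≤⟨ ∑-bound (suc b) (λ {d} _ → ℕ./-monoʳ-≤ n (s≤s (ℕ.m≤m+n b d))) ⟩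
    suc b * (n ℕ./ suc b)
      ≡⟨ ℕ.*-comm (suc b) _ ⟩
    n ℕ./ suc b * suc b
      ≤⟨ ℕ.m/n*n≤m n (suc b) ⟩
    n ∎

-- Counting monochromatic pairs in progressions.

length-filter-tabulate : ∀ {A : Set} {P : A → Set} (P? : ∀ x → Dec (P x)) n (f : Fin n → A) g →
  (∀ i → g (toℕ i) ≡ χ (P? (f i))) → ∑ n g ≡ length (filter P? (tabulate f))
length-filter-tabulate P? zero    f g eq = refl
length-filter-tabulate P? (suc n) f g eq with P? (f Fin.zero) | eq Fin.zero
... | yes _ | g0 = cong₂ _+_ g0 (length-filter-tabulate P? n (f ∘ Fin.suc) (g ∘ suc) (eq ∘ Fin.suc))
... | no  _ | g0 = cong₂ _+_ g0 (length-filter-tabulate P? n (f ∘ Fin.suc) (g ∘ suc) (eq ∘ Fin.suc))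

-- Values `v` up to `M` are paid for by the first summand, larger ones by the second. With `v` a
-- value of `τ`, this trades large divisor counts for their moment of order `suc p`.
threshold : ∀ M p v → v * M ^ p ≤ M ^ suc p + v ^ suc p
threshold M p v with ℕ.≤-total v M
... | inj₁ v≤M = ℕ.≤-trans (ℕ.*-monoˡ-≤ (M ^ p) v≤M) (ℕ.m≤m+n _ _)
... | inj₂ M≤v = ℕ.≤-trans (ℕ.*-monoʳ-≤ v (ℕ.^-monoˡ-≤ p M≤v)) (ℕ.m≤n+m _ _)

module MonochromaticPairs {t N} (c : Coloring t N) (n : ℕ) (classes : ∀ j → colorCount c j ≤ n)
  where

  -- The value t outside the domain differs from every color.
  color : ℕ → ℕ
  color x with x ℕ.<? N
  ... | yes x<N = toℕ (c (fromℕ< x<N))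
  ... | no  _   = t

  color-toℕ : ∀ i → color (toℕ i) ≡ toℕ (c i)
  color-toℕ i with toℕ i ℕ.<? N
  ... | yes i<N = cong (toℕ ∘ c) (Fin.fromℕ<-toℕ i i<N)
  ... | no  i≮N = contradiction (Fin.toℕ<n i) i≮N

  color-fromℕ< : ∀ {x} (x<N : x < N) → color x ≡ toℕ (c (fromℕ< x<N))
  color-fromℕ< x<N =
    trans (cong color (sym (Fin.toℕ-fromℕ< x<N))) (color-toℕ (fromℕ< x<N))

  color-outside : ∀ {x} → N ≤ x → color x ≡ t
  color-outside {x} N≤x with x ℕ.<? N
  ... | yes x<N = contradiction N≤x (ℕ.<⇒≱ x<N)
  ... | no  _   = refl

  E : ℕ → ℕ → ℕ
  E x y = χ (color y ℕ.≟ color x)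

  E-class : ∀ {x} → x < N → ∑[ y < N ] E x y ≤ n
  E-class {x} x<N = ℕ.≤-trans
    -- `colorCount` filters `allFin N`, which is `tabulate id`.
    (ℕ.≤-reflexive (length-filter-tabulate (λ i → c i Fin.≟ j) N id (E x) agree))
    (classes j)
    where
    j = c (fromℕ< x<N)
    agree : ∀ i → E x (toℕ i) ≡ χ (c i Fin.≟ j)
    agree i with c i Fin.≟ j
    ... | yes ci≡j = χ-true _ (trans (color-toℕ i) (trans (cong toℕ ci≡j) (sym (color-fromℕ< x<N))))
    ... | no  ci≢j = χ-false _ λ eq → ci≢j (Fin.toℕ-injective
      (trans (sym (color-toℕ i)) (trans eq (color-fromℕ< x<N))))

  E-outside : ∀ {x y} → x < N → N ≤ y → E x y ≤ 0
  E-outside {x} x<N N≤y = ℕ.≤-reflexive (χ-false _ λ eq → ℕ.<-irrefl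
    (trans (sym (color-fromℕ< x<N)) (trans (sym eq) (color-outside N≤y)))
    (Fin.toℕ<n (c (fromℕ< x<N))))

  E-later : ∀ {x} → x < N → ∑[ m < N ] E x (x + suc m) ≤ n
  E-later {x} x<N = ℕ.≤-trans (∑-reindex N N (λ y → y ∸ suc x) (λ {m} _ → hit m)) (E-class x<N)
    where
    hit : ∀ m → E x (x + suc m) ≤ 0 ⊎
      ∃[ y ] y < N × y ∸ suc x ≡ m × E x (x + suc m) ≤ E x y
    hit m with ℕ.<-≤-connex (x + suc m) N
    ... | inj₂ N≤ = inj₁ (E-outside x<N N≤)
    ... | inj₁ <N = inj₂ (x + suc m , <N
      , trans (cong (_∸ suc x) (ℕ.+-suc x m)) (ℕ.m+n∸m≡n (suc x) m) , ℕ.≤-refl)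

  module _ (k X : ℕ) where
    open Divisors k

    -- Pairs are grouped by their distance `suc m = suc e * suc d`. Each divisor `suc e` of the
    -- distance determines `suc d` by division, so a distance is met at most `τ (suc m)` times.
    pairs-from : ∀ {x} → x < N →
      ∑[ d < X ] ∑[ e < k ] E x (x + suc e * suc d) ≤ ∑[ m < N ] (E x (x + suc m) * τ (suc m))
    pairs-from {x} x<N = begin
      ∑[ d < X ] ∑[ e < k ] E x (x + suc e * suc d)
        ≡⟨ ∑-swap X k _ ⟩
      ∑[ e < k ] ∑[ d < X ] E x (x + suc e * suc d)
        ≤⟨ ∑-mono-all k (λ e → ∑-reindex X N (λ m → pred (suc m ℕ./ suc e)) (λ {d} _ → hit e d)) ⟩
      ∑[ e < k ] ∑[ m < N ] (E x (x + suc m) * χ (suc e ∣? suc m))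
        ≡⟨ ∑-swap k N _ ⟩
      ∑[ m < N ] ∑[ e < k ] (E x (x + suc m) * χ (suc e ∣? suc m))
        ≡⟨ ∑-cong N (λ m → ∑-distrib-* k (E x (x + suc m)) _) ⟩
      ∑[ m < N ] (E x (x + suc m) * τ (suc m)) ∎
      where
      open ℕ.≤-Reasoning
      hit : ∀ e d → E x (x + suc e * suc d) ≤ 0 ⊎
        ∃[ m ] m < N × pred (suc m ℕ./ suc e) ≡ d ×
        E x (x + suc e * suc d) ≤ E x (x + suc m) * χ (suc e ∣? suc m)
      hit e d with ℕ.<-≤-connex (x + suc e * suc d) N
      ... | inj₂ N≤ = inj₁ (E-outside x<N N≤)
      ... | inj₁ <N = inj₂ (d + e * suc d
        , ℕ.<⇒≤ (ℕ.≤-<-trans (ℕ.m≤n+m (suc e * suc d) x) <N)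
        , cong pred (trans (cong (ℕ._/ suc e) (ℕ.*-comm (suc e) (suc d))) (ℕ.m*n/n≡m (suc d) (suc e)))
        , ℕ.≤-reflexive (trans (sym (ℕ.*-identityʳ _))
            (cong (E x (x + suc e * suc d) *_) (sym (χ-true _ (m∣m*n (suc d)))))))

    module _ (h p M : ℕ) (harmonic-k : ∀ m → ∑[ d < k ] (m ℕ./ suc d) ≤ h * m) where

      R = order (suc p)

      -- `threshold` is applied to each `τ (suc m)`. Its first part is summed only over the points
      -- of the color of `x`, at most `n` of them; in its second part `E` is bounded by 1 and the
      -- moment is summed over all distances.
      pairs-bound : ∀ {x} → x < N →
        M ^ p * ∑[ d < X ] ∑[ e < k ] E x (x + suc e * suc d) ≤ M ^ suc p * n + h ^ R * N
      pairs-bound {x} x<N = begin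
        M ^ p * ∑[ d < X ] ∑[ e < k ] E x (x + suc e * suc d)
          ≤⟨ ℕ.*-monoʳ-≤ (M ^ p) (pairs-from x<N) ⟩
        M ^ p * ∑[ m < N ] (E x (x + suc m) * τ (suc m))
          ≡⟨ ∑-distrib-* N (M ^ p) _ ⟨
        ∑[ m < N ] (M ^ p * (E x (x + suc m) * τ (suc m)))
          ≤⟨ ∑-mono-all N split ⟩
        ∑[ m < N ] (M ^ suc p * E x (x + suc m) + τ^ R (suc m))
          ≡⟨ ∑-distrib-+ N _ _ ⟩
        ∑[ m < N ] (M ^ suc p * E x (x + suc m)) + ∑[ m < N ] τ^ R (suc m)
          ≡⟨ cong (_+ ∑[ m < N ] τ^ R (suc m)) (∑-distrib-* N (M ^ suc p) _) ⟩
        M ^ suc p * ∑[ m < N ] E x (x + suc m) + ∑[ m < N ] τ^ R (suc m)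
          ≤⟨ ℕ.+-mono-≤ (ℕ.*-monoʳ-≤ (M ^ suc p) (E-later x<N)) (∑-τ^ {h} harmonic-k R N) ⟩
        M ^ suc p * n + h ^ R * N ∎
        where
        open ℕ.≤-Reasoning
        split : ∀ m → M ^ p * (E x (x + suc m) * τ (suc m)) ≤
          M ^ suc p * E x (x + suc m) + τ^ R (suc m)
        split m = begin
          M ^ p * (e * v)
            ≡⟨ solve 3 (λ P e v → P :* (e :* v) := e :* (v :* P)) refl (M ^ p) e v ⟩
          e * (v * M ^ p)
            ≤⟨ ℕ.*-monoʳ-≤ e (threshold M p v) ⟩
          e * (M ^ suc p + v ^ suc p)
            ≡⟨ ℕ.*-distribˡ-+ e (M ^ suc p) (v ^ suc p) ⟩
          e * M ^ suc p + e * v ^ suc p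
            ≤⟨ ℕ.+-mono-≤ (ℕ.≤-reflexive (ℕ.*-comm e (M ^ suc p)))
                 (ℕ.≤-trans
                   (ℕ.*-monoˡ-≤ (v ^ suc p) (χ≤1 (color (x + suc m) ℕ.≟ color x)))
                   (ℕ.≤-reflexive (ℕ.*-identityˡ _))) ⟩
          M ^ suc p * e + v ^ suc p
            ≤⟨ ℕ.+-monoʳ-≤ (M ^ suc p * e) (τ-power (suc p) (suc m)) ⟩
          M ^ suc p * e + τ^ R (suc m) ∎
          where
          open +-*-Solver
          e = E x (x + suc m)
          v = τ (suc m)

      W : ℕ → ℕ → ℕ
      W x d = ∑[ e < k ] E x (x + suc e * suc d)

      -- Bounds the number of monochromatic pairs in the progression starting at a
      -- with difference suc d; it also counts pairs reaching beyond the last term.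
      defect : ℕ → ℕ → ℕ
      defect a d = ∑[ i < k ] W (i * suc d + a) d

      -- For a fixed position `i` and difference, the map from the start `a` to the term is a
      -- translation, and N = 2 k X keeps its values below `N`. So each of the `k` positions
      -- contributes at most the sum over all points `x`.
      total-defect : N ≡ k * X + k * X →
        M ^ p * ∑[ a < k * X ] ∑[ d < X ] defect a d ≤
        k * (N * (M ^ suc p * n + h ^ R * N))
      total-defect N≡ = begin
        M ^ p * ∑[ a < k * X ] ∑[ d < X ] ∑[ i < k ] W (i * suc d + a) d
          ≡⟨ cong (M ^ p *_) (trans (∑-cong (k * X) (λ a → ∑-swap X k _)) (trans (∑-swap (k * X) k _)
               (∑-cong k λ i → ∑-swap (k * X) X _))) ⟩
        M ^ p * ∑[ i < k ] ∑[ d < X ] ∑[ a < k * X ] W (i * suc d + a) d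
          ≤⟨ ℕ.*-monoʳ-≤ (M ^ p) (∑-bound k λ {i} i<k → ∑-mono X λ {d} d<X →
               ∑-shift (i * suc d) (λ x → W x d) (fits {i} i<k d<X)) ⟩
        M ^ p * (k * ∑[ d < X ] ∑[ x < N ] W x d)
          ≡⟨ cong (λ z → M ^ p * (k * z)) (∑-swap X N _) ⟩
        M ^ p * (k * ∑[ x < N ] ∑[ d < X ] W x d)
          ≡⟨ solve 3 (λ P k s → P :* (k :* s) := k :* (P :* s)) refl (M ^ p) k _ ⟩
        k * (M ^ p * ∑[ x < N ] ∑[ d < X ] W x d)
          ≡⟨ cong (k *_) (∑-distrib-* N (M ^ p) _) ⟨
        k * ∑[ x < N ] (M ^ p * ∑[ d < X ] W x d)
          ≤⟨ ℕ.*-monoʳ-≤ k (∑-bound N pairs-bound) ⟩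
        k * (N * (M ^ suc p * n + h ^ R * N)) ∎
        where
        open ℕ.≤-Reasoning
        open +-*-Solver
        fits : ∀ {i d} → i < k → d < X → i * suc d + k * X ≤ N
        fits i<k d<X = ℕ.≤-trans (ℕ.+-monoˡ-≤ (k * X) (ℕ.*-mono-≤ (ℕ.<⇒≤ i<k) d<X))
          (ℕ.≤-reflexive (sym N≡))

      -- Two terms of one color would contribute 1 to `W` at the earlier of them, and hence to the
      -- defect.
      rainbow-at : N ≡ k * X + k * X → ∀ {a d} → a < k * X → d < X → defect a d < 1 →
        ∃[ A ] Rainbow {k = k} c A
      rainbow-at N≡ {a} {d} a<kX d<X defect<1 = A , injective
        where
        term : ℕ → ℕ
        term i = i * suc d + a
        term< : ∀ {i} → i < k → term i < N
        term< {i} i<k = ℕ.≤-trans (ℕ.≤-trans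
          (ℕ.≤-reflexive (sym (ℕ.+-suc (i * suc d) a)))
          (ℕ.+-mono-≤ (ℕ.*-mono-≤ (ℕ.<⇒≤ i<k) d<X) a<kX))
          (ℕ.≤-reflexive (sym N≡))
        A : AP k N
        A = record
          -- The index `a` stands for the integer `suc a`.
          { start = suc a ; difference = suc d ; difference>0 = z<s
          ; term = λ i → fromℕ< (term< (Fin.toℕ<n i))
          ; term-eq = λ i → trans (cong suc (Fin.toℕ-fromℕ< (term< (Fin.toℕ<n i))))
              (cong suc (ℕ.+-comm (toℕ i * suc d) a)) }
        distinct : ∀ {i j} → i < j → j < k → color (term j) ≢ color (term i)
        distinct {i} {j} i<j j<k eq = ℕ.<-irrefl refl (begin-strict
          1
            ≡⟨ χ-true (color (term j) ℕ.≟ color (term i)) eq ⟨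
          E (term i) (term j)
            ≡⟨ cong (E (term i)) term-j ⟩
          E (term i) (term i + suc e * suc d)
            ≤⟨ term≤∑ (λ e → E (term i) (term i + suc e * suc d)) e<k ⟩
          W (term i) d
            ≤⟨ term≤∑ (λ i → W (term i) d) (ℕ.<-trans i<j j<k) ⟩
          defect a d
            <⟨ defect<1 ⟩
          1 ∎)
          where
          open ℕ.≤-Reasoning
          open +-*-Solver
          -- Chosen so that `suc e` is the gap j - i.
          e = j ∸ suc i
          j≡ : suc i + e ≡ j
          j≡ = ℕ.m+[n∸m]≡n i<j
          e<k : e < k
          e<k = ℕ.≤-<-trans (ℕ.m∸n≤m j (suc i)) j<k
          term-j : term j ≡ term i + suc e * suc d
          term-j = trans (cong term (sym j≡)) (solve 4
            (λ i e d a → (con 1 :+ i :+ e) :* d :+ a := i :* d :+ a :+ (con 1 :+ e) :* d)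
            refl i e (suc d) a)
        colors : ∀ {i j} → c (AP.term A i) ≡ c (AP.term A j) →
          color (term (toℕ i)) ≡ color (term (toℕ j))
        colors {i} {j} eq = trans (color-fromℕ< (term< (Fin.toℕ<n i)))
          (trans (cong toℕ eq) (sym (color-fromℕ< (term< (Fin.toℕ<n j)))))
        injective : Rainbow c A
        injective {i} {j} eq with ℕ.<-cmp (toℕ i) (toℕ j)
        ... | tri< i<j _ _ = contradiction (sym (colors {i} {j} eq)) (distinct i<j (Fin.toℕ<n j))
        ... | tri≈ _ i≡j _ = Fin.toℕ-injective i≡j
        ... | tri> _ _ j<i = contradiction (colors {i} {j} eq) (distinct j<i (Fin.toℕ<n i))

      -- Averaging over the k X starts and X differences: a total defect below k X X leaves some
      -- start with row sum below X, and in that row a difference with defect 0.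
      rainbow : N ≡ k * X + k * X →
        k * (N * (M ^ suc p * n + h ^ R * N)) < M ^ p * (k * X * X) →
        ∃[ A ] Rainbow {k = k} c A
      rainbow N≡ few =
        let a , a<kX , row<X = ∑-small-term (k * X) {λ a → ∑ X (defect a)}
              (ℕ.*-cancelˡ-< (M ^ p) _ _ (ℕ.≤-<-trans (total-defect N≡) few))
            d , d<X , defect<1 = ∑-small-term X {defect a}
              (subst (∑ X (defect a) <_) (sym (ℕ.*-identityʳ X)) row<X)
        in rainbow-at N≡ a<kX d<X defect<1

-- Choice of the number of colors.

-- The hypothesis on M ^ 5 makes the moment term h ^ 63 N at most the class term M ^ 6 n, so the
-- weighted total defect is at most twice the latter times k N.
forces-rainbow : ∀ k h M → 0 < k → 0 < M → k ≤ pred (2 ^ h) →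
  16 * k ^ 2 * h ^ 63 ≤ M ^ 5 → ForcesRainbow k (16 * k ^ 2 * M)
forces-rainbow k h M 0<k 0<M k≤ big n 0<n c equinumerous =
  -- The moment used is the sixth, and `order 6` is 63.
  rainbow k X h 5 M (λ m → ℕ.≤-trans (∑-monoˡ _ k≤) (harmonic h m)) N≡ few
  where
  open MonochromaticPairs c n (λ j → ℕ.≤-reflexive (equinumerous j))
  open +-*-Solver
  open ℕ.≤-Reasoning
  N = 16 * k ^ 2 * M * n
  X = 8 * k * M * n
  -- One variable for the ring solver; `M ^ 6` unfolds to `M * P`.
  P = M ^ 5
  N≡ : N ≡ k * X + k * X
  N≡ = solve 3 (λ k M n → con 16 :* k :^ 2 :* M :* n :=
    k :* (con 8 :* k :* M :* n) :+ k :* (con 8 :* k :* M :* n)) refl k M n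
  -- Common factor of the two sides: the defects total at most 32 `z`, while the weighted number of
  -- progressions is 64 `z`.
  z = k ^ 3 * M ^ 2 * n ^ 2 * P
  0<z : 0 < z
  0<z = >-nonZero⁻¹ z {{ℕ.m*n≢0 (k ^ 3 * M ^ 2 * n ^ 2) P
    {{ℕ.m*n≢0 (k ^ 3 * M ^ 2) (n ^ 2)
      {{ℕ.m*n≢0 (k ^ 3) (M ^ 2) {{ℕ.m^n≢0 k 3 {{>-nonZero 0<k}}}} {{ℕ.m^n≢0 M 2 {{>-nonZero 0<M}}}}}}
      {{ℕ.m^n≢0 n 2 {{>-nonZero 0<n}}}}}}
    {{ℕ.m^n≢0 M 5 {{>-nonZero 0<M}}}}}}
  few : k * (N * (M ^ 6 * n + h ^ 63 * N)) < M ^ 5 * (k * X * X)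
  few = begin-strict
    k * (N * (M * P * n + h ^ 63 * N))
      ≡⟨ solve 5 (λ k M n P F →
           k :* (con 16 :* k :^ 2 :* M :* n :* (M :* P :* n :+ F :* (con 16 :* k :^ 2 :* M :* n)))
           := con 16 :* k :^ 3 :* M :^ 2 :* n :^ 2 :* (P :+ con 16 :* k :^ 2 :* F))
           refl k M n P (h ^ 63) ⟩
    16 * k ^ 3 * M ^ 2 * n ^ 2 * (P + 16 * k ^ 2 * h ^ 63)
      ≤⟨ ℕ.*-monoʳ-≤ (16 * k ^ 3 * M ^ 2 * n ^ 2) (ℕ.+-monoʳ-≤ P big) ⟩
    16 * k ^ 3 * M ^ 2 * n ^ 2 * (P + P)
      ≡⟨ solve 4 (λ k M n P → con 16 :* k :^ 3 :* M :^ 2 :* n :^ 2 :* (P :+ P)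
           := con 32 :* (k :^ 3 :* M :^ 2 :* n :^ 2 :* P)) refl k M n P ⟩
    32 * z
      <⟨ ℕ.*-monoˡ-< z {{>-nonZero 0<z}} (ℕ.m<m+n 32 {32} z<s) ⟩
    64 * z
      ≡⟨ solve 4 (λ k M n P → con 64 :* (k :^ 3 :* M :^ 2 :* n :^ 2 :* P)
           := P :* (k :* (con 8 :* k :* M :* n) :* (con 8 :* k :* M :* n))) refl k M n P ⟩
    M ^ 5 * (k * X * X) ∎

-- Growth estimates and the bound on the square of T.

^-distribʳ-* : ∀ n a b → (a * b) ^ n ≡ a ^ n * b ^ n
^-distribʳ-* zero    a b = refl
^-distribʳ-* (suc n) a b = trans (cong (a * b *_) (^-distribʳ-* n a b))
  (interchange a b (a ^ n) (b ^ n))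
  where open import Algebra.Properties.CommutativeSemigroup ℕ.*-commutativeSemigroup

n<2^n : ∀ n → n < 2 ^ n
n<2^n zero    = z<s
n<2^n (suc n) = ℕ.≤-trans (ℕ.+-mono-≤ (ℕ.m^n>0 2 n) (n<2^n n))
  (ℕ.≤-reflexive (cong (_+_ (2 ^ n)) (sym (ℕ.+-identityʳ (2 ^ n)))))

-- With q the integer part of j / r, j is at most 2 ^ q r, and the r-th power of 2 ^ q is at most 2
-- ^ j. This absorbs the power of log k.
[j*2]^r≤C*2^j : ∀ r .{{_ : NonZero r}} j → (j * 2) ^ r ≤ (r * 2) ^ r * 2 ^ j
[j*2]^r≤C*2^j r j = begin
  (j * 2) ^ r                  ≤⟨ ℕ.^-monoˡ-≤ r (ℕ.*-monoˡ-≤ 2 j≤) ⟩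
  (2 ^ q * r * 2) ^ r          ≡⟨ cong (_^ r) (trans (ℕ.*-assoc (2 ^ q) r 2) (ℕ.*-comm (2 ^ q) (r * 2))) ⟩
  (r * 2 * 2 ^ q) ^ r          ≡⟨ ^-distribʳ-* r (r * 2) (2 ^ q) ⟩
  (r * 2) ^ r * (2 ^ q) ^ r    ≡⟨ cong ((r * 2) ^ r *_) (ℕ.^-*-assoc 2 q r) ⟩
  (r * 2) ^ r * 2 ^ (q * r)    ≤⟨ ℕ.*-monoʳ-≤ ((r * 2) ^ r) (ℕ.^-monoʳ-≤ 2 (ℕ.m/n*n≤m j r)) ⟩
  (r * 2) ^ r * 2 ^ j          ∎
  where
  open ℕ.≤-Reasoning
  q = j ℕ./ r
  j≤ : j ≤ 2 ^ q * r
  j≤ = begin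
    j                ≡⟨ ℕ.m≡m%n+[m/n]*n j r ⟩
    j ℕ.% r + q * r  ≤⟨ ℕ.+-monoˡ-≤ (q * r) (ℕ.<⇒≤ (ℕ.m%n<n j r)) ⟩
    suc q * r        ≤⟨ ℕ.*-monoˡ-≤ r (n<2^n q) ⟩
    2 ^ q * r        ∎

-- Supplies a power of two of order √k. By induction on k, it is doubled whenever its square no
-- longer exceeds k.
scale : ∀ k → 0 < k → ∃[ j ] k < (2 ^ j) ^ 2 × (2 ^ j) ^ 2 ≤ 4 * k
scale 1 _ = 1 , s≤s (s≤s z≤n) , ℕ.≤-refl
scale (suc k@(suc _)) _ with scale k z<s
... | j , k<s² , s²≤4k with ℕ.<-≤-connex (suc k) ((2 ^ j) ^ 2)
...   | inj₁ 1+k<s² = j , 1+k<s² , ℕ.≤-trans s²≤4k (ℕ.*-monoʳ-≤ 4 (ℕ.n≤1+n k))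
...   | inj₂ s²≤1+k = suc j , 1+k<4s² , ℕ.≤-trans (ℕ.≤-reflexive quadruple) (ℕ.*-monoʳ-≤ 4 s²≤1+k)
  where
  open +-*-Solver
  quadruple : (2 ^ suc j) ^ 2 ≡ 4 * (2 ^ j) ^ 2
  quadruple = solve 1 (λ s → (con 2 :* s) :^ 2 := con 4 :* s :^ 2) refl (2 ^ j)
  1+k<4s² : suc k < (2 ^ suc j) ^ 2
  1+k<4s² = ℕ.≤-<-trans k<s² (ℕ.<-≤-trans
    (ℕ.m<m+n ((2 ^ j) ^ 2) {3 * (2 ^ j) ^ 2}
      (ℕ.*-mono-≤ {1} {3} (s≤s z≤n) (ℕ.m^n>0 (2 ^ j) {{ℕ.m^n≢0 2 j}} 2)))
    (ℕ.≤-reflexive (sym quadruple)))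

-- With s = 2 ^ j of order √k, the choices h = 2 j and M = K s meet the conditions of
-- `forces-rainbow`, and minimality gives T at most 16 k² K s. Squaring turns k ^ (5/2) into an
-- integer power.
T²-bound : ∀ {C K} → (∀ j → (j * 2) ^ 63 ≤ C * 2 ^ j) → 0 < K → 16 * C ≤ K →
  ∀ k T → 0 < k → IsT k T → T ^ 2 ≤ (32 * K) ^ 2 * k ^ 5
T²-bound {C} {K} polylog 0<K 16C≤K k T 0<k (_ , _ , least) =
  let j , k<s² , s²≤4k = scale k 0<k in bound j (2 ^ j) refl k<s² s²≤4k
  where
  open ℕ.≤-Reasoning
  open +-*-Solver
  bound : ∀ j s → s ≡ 2 ^ j → k < s ^ 2 → s ^ 2 ≤ 4 * k → T ^ 2 ≤ (32 * K) ^ 2 * k ^ 5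
  bound j s s≡2^j k<s² s²≤4k = begin
    T ^ 2
      ≤⟨ ℕ.^-monoˡ-≤ 2 (least (16 * k ^ 2 * (K * s)) 0<t
           (forces-rainbow k (j * 2) (K * s) 0<k 0<M k≤ large)) ⟩
    (16 * k ^ 2 * (K * s)) ^ 2
      ≡⟨ solve 3 (λ k K s → (con 16 :* k :^ 2 :* (K :* s)) :^ 2 :=
           con 256 :* K :^ 2 :* k :^ 4 :* s :^ 2) refl k K s ⟩
    256 * K ^ 2 * k ^ 4 * s ^ 2
      ≤⟨ ℕ.*-monoʳ-≤ (256 * K ^ 2 * k ^ 4) s²≤4k ⟩
    256 * K ^ 2 * k ^ 4 * (4 * k)
      ≡⟨ solve 2 (λ k K → con 256 :* K :^ 2 :* k :^ 4 :* (con 4 :* k) :=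
           (con 32 :* K) :^ 2 :* k :^ 5) refl k K ⟩
    (32 * K) ^ 2 * k ^ 5 ∎
    where
    0<M : 0 < K * s
    0<M = ℕ.*-mono-≤ 0<K (subst (0 <_) (sym s≡2^j) (ℕ.m^n>0 2 j))
    0<t : 0 < 16 * k ^ 2 * (K * s)
    0<t = ℕ.*-mono-≤ {1} {16 * k ^ 2}
      (ℕ.*-mono-≤ {1} {16} (s≤s z≤n) (ℕ.m^n>0 k {{>-nonZero 0<k}} 2)) 0<M
    k≤ : k ≤ pred (2 ^ (j * 2))
    k≤ = subst (λ x → k ≤ pred x) (trans (cong (_^ 2) s≡2^j) (ℕ.^-*-assoc 2 j 2)) (ℕ.<⇒≤pred k<s²)
    large : 16 * k ^ 2 * (j * 2) ^ 63 ≤ (K * s) ^ 5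
    -- As k is below s², the left side is at most 16 s⁴ times C s, which is where the fifth power of
    -- s comes from.
    large = begin
      16 * k ^ 2 * (j * 2) ^ 63
        ≤⟨ ℕ.*-mono-≤ (ℕ.*-monoʳ-≤ 16 (ℕ.^-monoˡ-≤ 2 (ℕ.<⇒≤ k<s²)))
             (subst (λ x → (j * 2) ^ 63 ≤ C * x) (sym s≡2^j) (polylog j)) ⟩
      16 * (s ^ 2) ^ 2 * (C * s)
        ≡⟨ solve 2 (λ s C → con 16 :* (s :^ 2) :^ 2 :* (C :* s) := con 16 :* C :* s :^ 5) refl s C ⟩
      16 * C * s ^ 5
        ≤⟨ ℕ.*-monoˡ-≤ (s ^ 5) 16C≤K ⟩
      K * s ^ 5
        ≤⟨ ℕ.*-monoˡ-≤ (s ^ 5) (ℕ.m≤m*n K (K ^ 4) {{ℕ.m^n≢0 K 4 {{>-nonZero 0<K}}}}) ⟩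
      K ^ 5 * s ^ 5
        ≡⟨ ^-distribʳ-* 5 K s ⟨
      (K * s) ^ 5 ∎

-- Passage to the real inequality.

ι-+ : ∀ m n → ι (m + n) ≡ ι m ℚ.+ ι n
ι-+ zero    n = sym (ℚ.+-identityˡ (ι n))
ι-+ (suc m) n = begin
  ι (suc (m + n))           ≡⟨ ι-suc (m + n) ⟩
  1ℚ ℚ.+ ι (m + n)          ≡⟨ cong (ℚ._+_ 1ℚ) (ι-+ m n) ⟩
  1ℚ ℚ.+ (ι m ℚ.+ ι n)      ≡⟨ ℚ.+-assoc 1ℚ (ι m) (ι n) ⟨
  1ℚ ℚ.+ ι m ℚ.+ ι n        ≡⟨ cong (ℚ._+ ι n) (ι-suc m) ⟨
  ι (suc m) ℚ.+ ι n         ∎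
  where open ≡-Reasoning

ι-* : ∀ m n → ι (m * n) ≡ ι m ℚ.* ι n
ι-* zero    n = sym (ℚ.*-zeroˡ (ι n))
ι-* (suc m) n = begin
  ι (n + m * n)                  ≡⟨ ι-+ n (m * n) ⟩
  ι n ℚ.+ ι (m * n)              ≡⟨ cong (ℚ._+_ (ι n)) (ι-* m n) ⟩
  ι n ℚ.+ ι m ℚ.* ι n            ≡⟨ cong (ℚ._+ ι m ℚ.* ι n) (ℚ.*-identityˡ (ι n)) ⟨
  1ℚ ℚ.* ι n ℚ.+ ι m ℚ.* ι n     ≡⟨ ℚ.*-distribʳ-+ (ι n) 1ℚ (ι m) ⟨
  (1ℚ ℚ.+ ι m) ℚ.* ι n           ≡⟨ cong (ℚ._* ι n) (ι-suc m) ⟨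
  ι (suc m) ℚ.* ι n              ∎
  where open ≡-Reasoning

ι-^ : ∀ m n → ι (m ^ n) ≡ ι m ^ℚ n
ι-^ m zero    = refl
ι-^ m (suc n) = trans (ι-* m (m ^ n)) (cong (ι m ℚ.*_) (ι-^ m n))

ι-pos : ∀ {n} → 0 < n → 0ℚ ℚ.< ι n
ι-pos {suc n} _ = ℚ.<-≤-trans 0<1 (ι-mono-≤ {1} {suc n} (s≤s z≤n))

<-dense-positive : ∀ {x y} → 0ℚ ℚ.< y → x ℚ.< y → ∃[ z ] 0ℚ ℚ.< z × x ℚ.< z × z ℚ.< y
<-dense-positive {x} {y} 0<y x<y =
  let z , max<z , z<y = ℚ.<-dense max<y
  in z , ℚ.≤-<-trans (ℚ.p≤p⊔q 0ℚ x) max<z , ℚ.≤-<-trans (ℚ.p≤q⊔p 0ℚ x) max<z , z<y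
  where
  max<y : 0ℚ ℚ.⊔ x ℚ.< y
  max<y = [ (λ eq → subst (ℚ._< y) (sym eq) 0<y) , (λ eq → subst (ℚ._< y) (sym eq) x<y) ]′
    (ℚ.⊔-sel 0ℚ x)

-- α = 5/2 + ε exceeds 5/2, so s² ≤ k⁵ already places every b < s below k ^ α.
below-power : ∀ (ε : ℝ⁺) k .{{_ : NonZero k}} {b s} → b ℚ.< s → 0ℚ ℚ.< s →
  s ^ℚ 2 ℚ.≤ ι k ^ℚ 5 → ℝ⁺.L (k ^ʳ (fromℚ (+ 5 / 2) +ʳ ε)) b
-- The exponent 5/2 is written `+ 5 / suc 1`.
below-power ε k {b} {s} b<s 0<s s²≤k⁵ = s , 5 , 1 , b<s , 0<s , s²≤k⁵ , exceeds
  where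
  five-halves = + 5 / 2
  exceeds : ℝ⁺.L (fromℚ five-halves +ʳ ε) five-halves
  exceeds with L-pos ε
  -- A sum of lower elements must exceed 5/2 strictly: `a` is taken below 5/2 by less than `e`.
  ... | e , 0<e , Le with <-dense-positive (ℚ.positive⁻¹ five-halves)
    (subst (five-halves ℚ.- e ℚ.<_) (ℚ.+-identityʳ five-halves)
      (ℚ.+-monoʳ-< five-halves (ℚ.neg-antimono-< 0<e)))
  ...   | a , 0<a , 5/2-e<a , a<5/2 =
    a , e , (0<a , a<5/2) , (0<e , Le) ,
    subst (ℚ._< a ℚ.+ e)
      (S.solve 2 (λ x e → (x S.:- e) S.:+ e S.:= x) refl five-halves e)
      (ℚ.+-monoˡ-< e 5/2-e<a)

-- Lower cuts are strict, so the constant is `suc B`, with `B` in its lower cut. A positive r′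
-- strictly between r and T gives b = r′ / B below s = T / B, and s² is at most k⁵.
bound-transfer : ∀ B → 0 < B → ∀ k .{{_ : NonZero k}} T → 0 < T → T ^ 2 ≤ B ^ 2 * k ^ 5 →
  ∀ ε {r} → r ℚ.< ι T → ℝ⁺.L (fromℕ (suc B) *ʳ k ^ʳ (fromℚ (+ 5 / 2) +ʳ ε)) r
bound-transfer B 0<B k T 0<T T²≤B²k⁵ ε {r} r<T =
  let r′ , 0<r′ , r<r′ , r′<T = <-dense-positive (ι-pos 0<T) r<T
      b , 0<b , bB≡r′ = divide-pos 0<r′ 0<ιB
      s , 0<s , sB≡T = divide-pos (ι-pos 0<T) 0<ιB
  in ι B , b , (0<ιB , ιB<ι[1+B]) ,
     (0<b , below-power ε k (b<s {b} {s} bB≡r′ sB≡T r′<T) 0<s (s²≤k⁵ {s} sB≡T)) ,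
     subst (r ℚ.<_) (trans (sym bB≡r′) (ℚ.*-comm b (ι B))) r<r′
  where
  0<ιB : 0ℚ ℚ.< ι B
  0<ιB = ι-pos 0<B
  ιB<ι[1+B] : ι B ℚ.< ι (suc B)
  ιB<ι[1+B] = subst (ι B ℚ.<_) (trans (ℚ.+-comm (ι B) 1ℚ) (sym (ι-suc B))) (x<x+d (ι B) 0<1)
  ι-bound : ι T ^ℚ 2 ℚ.≤ ι B ^ℚ 2 ℚ.* ι k ^ℚ 5
  ι-bound = subst₂ ℚ._≤_ (ι-^ T 2)
    (trans (ι-* (B ^ 2) (k ^ 5)) (cong₂ ℚ._*_ (ι-^ B 2) (ι-^ k 5))) (ι-mono-≤ T²≤B²k⁵)
  b<s : ∀ {b s r′} → b ℚ.* ι B ≡ r′ → s ℚ.* ι B ≡ ι T → r′ ℚ.< ι T → b ℚ.< s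
  b<s {b} {s} bB≡r′ sB≡T r′<T = ℚ.*-cancelʳ-<-nonNeg (ι B) {{ℚ.nonNegative (ℚ.<⇒≤ 0<ιB)}} {b} {s}
    (subst₂ ℚ._<_ (sym bB≡r′) (sym sB≡T) r′<T)
  s²≤k⁵ : ∀ {s} → s ℚ.* ι B ≡ ι T → s ^ℚ 2 ℚ.≤ ι k ^ℚ 5
  s²≤k⁵ {s} sB≡T = ℚ.*-cancelˡ-≤-pos (ι B ^ℚ 2) {{ℚ.positive (^-pos 2 0<ιB)}}
    (subst (ℚ._≤ ι B ^ℚ 2 ℚ.* ι k ^ℚ 5)
      (trans (cong (_^ℚ 2) (sym sB≡T))
        (trans (Exp.^-distrib-* s (ι B) 2) (ℚ.*-comm (s ^ℚ 2) (ι B ^ℚ 2))))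
      ι-bound)

theorem4 : (ε : ℝ⁺) →
    ∃[ C ] ((k : ℕ) → .{{_ : NonZero k}} → 3 ≤ k →
    (T : ℕ) → .{{_ : NonZero T}} → IsT k T →
    fromℕ T ≤ʳ C *ʳ k ^ʳ (fromℚ (+ 5 / 2) +ʳ ε))
theorem4 ε = fromℕ (suc B) , λ k 3≤k T isT@(0<T , _) r r<T →
  bound-transfer B z<s k T 0<T
    (T²-bound {C} {suc (16 * C)} ([j*2]^r≤C*2^j 63) z<s (ℕ.n≤1+n (16 * C))
      k T (ℕ.≤-trans z<s 3≤k) isT)
    ε r<T
  where
  -- `C` is the constant of `[j*2]^r≤C*2^j` at r = 63, and `B` is 32 K for K = 16 C + 1, which is
  -- positive and at least 16 C.
  C = (63 * 2) ^ 63
  B = 32 * suc (16 * C)
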